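{- Let $n \ge m > 1$ be integers and let $A$ be an $n\times n$ matrix with all entries in $\{+1,-1\}$. Let $Z(m,A)$ be the number of zero minors of order $m$ of $A$ and $Y(m,A)$ the number of nonzero minors of order $m$ of $A$. Then $$Y(m,A) \le 4\left(\frac{n}{4}\right)^m\binom{n}{m}$$ and $$Z(m,A) \ge \binom{n}{m}\left\{\binom{n}{m} - 4\left(\frac{n}{4}\right)^m\right\}.$$ Moreover, if $m \le 3$, then equality occurs (in each of these inequalities) if and only if $A$ is a Hadamard matrix.
   Context: A minor of order $m$ of $A$ is the determinant of an $m\times m$ submatrix of $A$, obtained by choosing $m$ of the rows and $m$ of the columns of $A$ (not necessarily consecutive). Minors are counted by the choice of rows and columns, so there are exactly $\binom{n}{m}^2$ minors of order $m$ and $Y(m,A)+Z(m,A)=\binom{n}{m}^2$. A Hadamard matrix of order $n$ is an $n\times n$ matrix $H$ with entries in $\{+1,-1\}$ satisfying $HH^T = nI$. -}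

module Defs where

open import Data.Bool.Base using (if_then_else_)
open import Data.Empty using (⊥)
open import Data.Fin.Base as Fin using (Fin; zero; suc; toℕ; punchIn)
import Data.Fin.Properties as Fin
open import Data.Integer.Base using (ℤ; +_; 0ℤ; 1ℤ; -1ℤ; _*_; _^_)
import Data.Integer.Properties as ℤ
open import Data.List.Base using (List; []; _∷_; _++_; filter; length; cartesianProduct)
import Data.List.Base as List
open import Data.List.Membership.Propositional using (_∈_)
open import Data.List.Membership.Propositional.Properties
  using (∈-++⁺ˡ; ∈-++⁺ʳ; ∈-++⁻; ∈-map⁺; ∈-map⁻)
open import Data.List.Relation.Unary.Any using (here)
import Data.List.Relation.Unary.All as ListAll
import Data.List.Relation.Unary.AllPairs as ListAllPairs
open import Data.List.Relation.Unary.Unique.Propositional using (Unique)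
open import Data.List.Relation.Unary.Unique.Propositional.Properties using (map⁺; ++⁺)
open import Data.Nat.Base using (ℕ; zero; suc; z<s; s<s; s<s⁻¹)
import Data.Nat.Properties as ℕ
open import Data.Product.Base using (_×_; _,_; ∃-syntax)
open import Data.Rational.Base as ℚ using (ℚ)
open import Data.Sum.Base using (_⊎_; inj₁; inj₂)
open import Data.Vec.Base as Vec using (Vec; []; _∷_; lookup)
open import Data.Vec.Functional using (Vector; transpose)
open import Data.Vec.Properties using (∷-injective; ∷-injectiveʳ)
open import Data.Vec.Relation.Unary.All as All using (All; []; _∷_)
import Data.Vec.Relation.Unary.All.Properties as All
open import Data.Vec.Relation.Unary.AllPairs using (AllPairs; []; _∷_)
open import Function.Base using (_∘_)
open import Relation.Binary.PropositionalEquality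
  using (_≡_; refl; cong; cong₂)
open import Relation.Nullary.Decidable using (does; ¬?)

open import Algebra.Definitions.RawSemiring ℚ.+-*-rawSemiring public
  using () renaming (_^_ to _^ℚ_)
open import Algebra.Properties.Semiring.Sum ℤ.+-*-semiring using (sum)

Matrix : Set → ℕ → ℕ → Set
Matrix A m n = Vector (Vector A n) m

infixl 7 _⊗_

_⊗_ : ∀ {m n p} → Matrix ℤ m n → Matrix ℤ n p → Matrix ℤ m p
(A ⊗ B) i j = sum λ k → A i k * B k j

scalar : ∀ {n} → ℤ → Matrix ℤ n n
scalar c i j = if does (i Fin.≟ j) then c else 0ℤ

-- Laplace expansion along the first row; the empty determinant is 1.
det : ∀ {n} → Matrix ℤ n n → ℤ
det {zero}  A = 1ℤ
det {suc n} A =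
  sum λ j → -1ℤ ^ toℕ j * A zero j * det (λ i k → A (suc i) (punchIn j k))

SignMatrix : ∀ {m n} → Matrix ℤ m n → Set
SignMatrix A = ∀ i j → A i j ≡ 1ℤ ⊎ A i j ≡ -1ℤ

record IsHadamard {n} (H : Matrix ℤ n n) : Set where
  field
    entries : SignMatrix H
    HHᵀ≡nI  : ∀ i j → (H ⊗ transpose H) i j ≡ scalar (+ n) i j

sucs : ∀ {n m} → Vec (Fin n) m → Vec (Fin (suc n)) m
sucs = Vec.map suc

zero∷_ : ∀ {n m} → Vec (Fin n) m → Vec (Fin (suc n)) (suc m)
zero∷ v = zero ∷ sucs v

-- The m-element subsets of Fin n, each listed once, as its elements in
-- increasing order (see ∈-choices⁺, ∈-choices⁻ and choices-unique).
choices : ∀ n m → List (Vec (Fin n) m)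
choices n       zero    = [] ∷ []
choices zero    (suc m) = []
choices (suc n) (suc m) =
  List.map zero∷_ (choices n m) ++ List.map sucs (choices n (suc m))

submatrix : ∀ {n m} → Matrix ℤ n n → Vec (Fin n) m → Vec (Fin n) m → Matrix ℤ m m
submatrix A rows cols i j = A (lookup rows i) (lookup cols j)

-- One entry for each choice of m rows and m columns, so equal values are
-- repeated.
minors : ∀ {n} → ℕ → Matrix ℤ n n → List ℤ
minors {n} m A =
  List.map (λ (rows , cols) → det (submatrix A rows cols))
    (cartesianProduct (choices n m) (choices n m))

Z : ∀ {n} → ℕ → Matrix ℤ n n → ℕ
Z m A = length (filter (ℤ._≟ 0ℤ) (minors m A))

Y : ∀ {n} → ℕ → Matrix ℤ n n → ℕ
Y m A = length (filter (λ d → ¬? (d ℤ.≟ 0ℤ)) (minors m A))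

fromℕ : ℕ → ℚ
fromℕ k = + k ℚ./ 1

Increasing : ∀ {n m} → Vec (Fin n) m → Set
Increasing v = AllPairs Fin._<_ v

private
  unsuc : ∀ {n m} (v : Vec (Fin (suc n)) m) → All (zero {n} Fin.<_) v →
          ∃[ w ] v ≡ sucs w
  unsuc []          []       = [] , refl
  unsuc (suc x ∷ v) (_ ∷ ps) with w , eq ← unsuc v ps = x ∷ w , cong (suc x ∷_) eq

  increasing-suc⁺ : ∀ {n m} {v : Vec (Fin n) m} →
                    Increasing v → Increasing (sucs v)
  increasing-suc⁺ []       = []
  increasing-suc⁺ (p ∷ ps) = All.map⁺ (All.map s<s p) ∷ increasing-suc⁺ ps

  increasing-suc⁻ : ∀ {n m} (v : Vec (Fin n) m) →
                    Increasing (sucs v) → Increasing v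
  increasing-suc⁻ []      []       = []
  increasing-suc⁻ (x ∷ v) (p ∷ ps) =
    All.map s<s⁻¹ (All.map⁻ p) ∷ increasing-suc⁻ v ps

  zero<suc : ∀ {n m} (v : Vec (Fin n) m) → All (zero {n} Fin.<_) (sucs v)
  zero<suc []      = []
  zero<suc (x ∷ v) = z<s ∷ zero<suc v

  suc-inj : ∀ {n m} {v w : Vec (Fin n) m} → sucs v ≡ sucs w → v ≡ w
  suc-inj {v = []}    {[]}    _  = refl
  suc-inj {v = _ ∷ _} {_ ∷ _} eq with p , q ← ∷-injective eq =
    cong₂ _∷_ (Fin.suc-injective p) (suc-inj q)

∈-choices⁺ : ∀ {n m} {v : Vec (Fin n) m} → Increasing v → v ∈ choices n m
∈-choices⁺ {v = []} [] = here refl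
∈-choices⁺ {suc n} {v = zero ∷ v} (p ∷ ps) with w , refl ← unsuc v p =
  ∈-++⁺ˡ (∈-map⁺ _ (∈-choices⁺ (increasing-suc⁻ w ps)))
∈-choices⁺ {suc n} {v = suc x ∷ v} (p ∷ ps)
  with w , refl ← unsuc v (All.map (ℕ.<-trans z<s) p) =
  ∈-++⁺ʳ _ (∈-map⁺ _ (∈-choices⁺ (increasing-suc⁻ (x ∷ w) (p ∷ ps))))

∈-choices⁻ : ∀ {n m} {v : Vec (Fin n) m} → v ∈ choices n m → Increasing v
∈-choices⁻ {m = zero} (here refl) = []
∈-choices⁻ {suc n} {suc m} v∈ with ∈-++⁻ (List.map zero∷_ (choices n m)) v∈
... | inj₁ q with w , w∈ , refl ← ∈-map⁻ zero∷_ q =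
  zero<suc w ∷ increasing-suc⁺ (∈-choices⁻ w∈)
... | inj₂ q with w , w∈ , refl ← ∈-map⁻ sucs q = increasing-suc⁺ (∈-choices⁻ w∈)

choices-unique : ∀ n m → Unique (choices n m)
choices-unique n       zero    = ListAll.[] ListAllPairs.∷ ListAllPairs.[]
choices-unique zero    (suc m) = ListAllPairs.[]
choices-unique (suc n) (suc m) =
  ++⁺ (map⁺ (suc-inj ∘ ∷-injectiveʳ) (choices-unique n m))
      (map⁺ suc-inj (choices-unique n (suc m)))
      disjoint
  where
  disjoint : ∀ {v} → v ∈ List.map zero∷_ (choices n m) ×
             v ∈ List.map sucs (choices n (suc m)) → ⊥
  disjoint (p , q) with ∈-map⁻ zero∷_ p | ∈-map⁻ sucs q
  ... | _ , _ , refl | (_ ∷ _) , _ , ()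

{-# OPTIONS --safe #-}

-- For a vector u and a form x of the exterior algebra of ℤⁿ, wedging with u and
-- contraction by u are adjoint and anticommute up to the scalar u · u, so that
-- |u ∧ x|² + |u ⌟ x|² = |u|² |x|². By Laplace expansion the coefficients of the
-- wedge of m rows of A are the minors on these rows, so the sum of the squares of
-- these minors is at most nᵐ, with equality exactly for orthogonal rows. A sign
-- matrix of order m has determinant divisible by 2ᵐ⁻¹, so a nonzero minor
-- contributes at least 4ᵐ⁻¹; as it is also at most m!, it contributes exactly 4ᵐ⁻¹
-- when m ≤ 3.
module Submission where

open import Defs
open import Data.Fin.Base as Fin using (Fin; zero; suc; toℕ; punchIn)
import Data.Fin.Properties as Fin
open import Data.Fin.Subset using (Subset; inside; outside; ⊤)
open import Data.Integer.Base as ℤ using (ℤ; +_; +[1+_]; -[1+_]; 0ℤ; 1ℤ; -1ℤ; +≤+; ∣_∣)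
open import Data.Integer.Divisibility.Signed
  using (_∣_; divides; ∣m∣n⇒∣m+n; ∣n⇒∣m*n; *-monoʳ-∣; *-cancelˡ-∣)
import Data.Integer.Properties as ℤ
open import Data.Integer.Tactic.RingSolver using (solve-∀)
open import Data.List.Base as List using (List; []; _∷_; _++_; length; filter; cartesianProduct)
import Data.List.Properties as List
open import Data.List.Relation.Unary.All as All using (All; []; _∷_)
import Data.List.Relation.Unary.All.Properties as All
open import Data.Nat.Base as ℕ using (ℕ; zero; suc; z≤n; s≤s; z<s; s<s; _!)
open import Data.Nat.Combinatorics using (_C_; nCk+nC[k+1]≡[n+1]C[k+1])
import Data.Nat.Coprimality as ℕ
import Data.Nat.Properties as ℕ
open import Data.Product.Base using (_×_; _,_; proj₁; proj₂; ∃-syntax; ∃₂)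
open import Data.Rational.Base as ℚ using (ℚ; mkℚ; _/_)
import Data.Rational.Properties as ℚ
open import Data.Rational.Solver using (module +-*-Solver)
open import Data.Rational.Unnormalised.Base as ℚᵘ using (mkℚᵘ; *≡*)
import Data.Rational.Unnormalised.Properties as ℚᵘ
open import Data.Sum.Base as Sum using (_⊎_; inj₁; inj₂; [_,_]′)
open import Data.Vec.Base as Vec using (Vec; []; _∷_; lookup; removeAt; allFin)
open import Data.Vec.Functional using (Vector; tail; transpose)
open import Data.Vec.Properties using (lookup-map; lookup-allFin; allFin-map)
open import Data.Vec.Relation.Unary.All using ([]; _∷_)
open import Data.Vec.Relation.Unary.AllPairs as AllPairs using ([]; _∷_)
open import Data.Vec.Relation.Unary.Unique.Propositional.Properties using (lookup-injective)
open import Function.Base using (_∘_; id)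
open import Function.Bundles using (_⇔_; mk⇔)
open import Function.Construct.Composition using (_⇔-∘_)
open import Relation.Binary.Definitions using (tri<; tri≈; tri>)
open import Relation.Binary.PropositionalEquality
open import Relation.Nullary.Decidable using (yes; no; ¬?)
open import Relation.Nullary.Negation using (contradiction)

open import Algebra.Properties.AbelianGroup ℤ.+-0-abelianGroup
  using () renaming (∙-cancelˡ to +-cancelˡ)
open import Algebra.Properties.Semiring.Sum ℤ.+-*-semiring
  using (sum; sum-cong-≗; *-distribˡ-sum)

-- The bound is C(n,m) n^m / 4^(m-1) = 4 (n/4)^m C(n,m): one factor n^m for each choice of rows,
-- divided by the least square of a nonzero minor. A wedge grows by one row at a time. If W is the
-- wedge of the later rows and b is the new row, the defect |b|² |W|² - |b ∧ W|² is exactly |b ⌟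
-- W|², so equality means b ⌟ W = 0. The delicate point is to read off from this that b is
-- orthogonal to each row of W; it is done once those rows are known to be orthogonal to each other,
-- which makes W nonzero. Orthogonality within each choice of rows then gives orthogonality of all
-- rows of A, because any two of them lie in a common choice when 1 < m ≤ n. All recursions on forms
-- split off the first basis vector e: x = e ∧ x₀ + x₁, where x₀ and x₁ restrict x to `inside` and
-- `outside`. The sign -1 comes from moving a vector past e.

private variable
  n m : ℕ

module _ where

  open import Data.Integer.Base using (_+_; _*_; _^_; _≤_)

  -- The exterior algebra of ℤⁿ

  infix 8 _·_
  _·_ : Vector ℤ n → Vector ℤ n → ℤ
  u · v = sum λ k → u k * v k

  ·-comm : ∀ (u v : Vector ℤ n) → u · v ≡ v · u
  ·-comm u v = sum-cong-≗ (λ i → ℤ.*-comm (u i) (v i))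

  -- The full exterior algebra of ℤⁿ: x S is the coefficient of x at the wedge
  -- of the basis vectors in S, taken in increasing order.
  Form : ℕ → Set
  Form n = Subset n → ℤ

  -- The factors 1ℤ and -1ℤ make every component a linear combination
  -- a * x + b * y on the nose, as the linearity lemmas require.
  infixr 9 _∧_ _⌟_

  _∧_ : Vector ℤ n → Form n → Form n
  (u ∧ x) []            = 0ℤ
  (u ∧ x) (inside ∷ S)  =
    u zero * x (outside ∷ S) + -1ℤ * (tail u ∧ λ T → x (inside ∷ T)) S
  (u ∧ x) (outside ∷ S) = (tail u ∧ λ T → x (outside ∷ T)) S

  _⌟_ : Vector ℤ n → Form n → Form n
  (u ⌟ x) []            = 0ℤ
  (u ⌟ x) (inside ∷ S)  = -1ℤ * (tail u ⌟ λ T → x (inside ∷ T)) S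
  (u ⌟ x) (outside ∷ S) =
    u zero * x (inside ∷ S) + 1ℤ * (tail u ⌟ λ T → x (outside ∷ T)) S

  ⟪_,_⟫ : Form n → Form n → ℤ
  ⟪_,_⟫ {zero}  x y = x [] * y []
  ⟪_,_⟫ {suc n} x y =
    ⟪ (λ S → x (inside ∷ S)) , (λ S → y (inside ∷ S)) ⟫ +
    ⟪ (λ S → x (outside ∷ S)) , (λ S → y (outside ∷ S)) ⟫

  ∧-cong : ∀ {u v : Vector ℤ n} {x y} → u ≗ v → x ≗ y → u ∧ x ≗ v ∧ y
  ∧-cong u≗v x≗y []            = refl
  ∧-cong u≗v x≗y (inside ∷ S)  =
    cong₂ (λ a b → a + -1ℤ * b) (cong₂ _*_ (u≗v zero) (x≗y _))
      (∧-cong (λ i → u≗v (suc i)) (λ T → x≗y (inside ∷ T)) S)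
  ∧-cong u≗v x≗y (outside ∷ S) =
    ∧-cong (λ i → u≗v (suc i)) (λ T → x≗y (outside ∷ T)) S

  ∧-congˡ : ∀ (u : Vector ℤ n) {x y} → x ≗ y → u ∧ x ≗ u ∧ y
  ∧-congˡ u = ∧-cong (λ _ → refl)

  ⟪⟫-cong : ∀ {x x′ y y′ : Form n} → x ≗ x′ → y ≗ y′ → ⟪ x , y ⟫ ≡ ⟪ x′ , y′ ⟫
  ⟪⟫-cong {zero}  p q = cong₂ _*_ (p []) (q [])
  ⟪⟫-cong {suc n} p q =
    cong₂ _+_ (⟪⟫-cong (λ S → p (inside ∷ S)) (λ S → q (inside ∷ S)))
              (⟪⟫-cong (λ S → p (outside ∷ S)) (λ S → q (outside ∷ S)))

  ∧-linear : ∀ (u : Vector ℤ n) a b x y S →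
    (u ∧ λ T → a * x T + b * y T) S ≡ a * (u ∧ x) S + b * (u ∧ y) S
  ∧-linear u a b x y []            = lemma a b
    where
    lemma : ∀ a b → 0ℤ ≡ a * 0ℤ + b * 0ℤ
    lemma = solve-∀
  ∧-linear u a b x y (inside ∷ S)  = trans
    (cong (λ c → u zero * (a * x (outside ∷ S) + b * y (outside ∷ S)) + -1ℤ * c)
      (∧-linear (tail u) a b (λ T → x (inside ∷ T)) (λ T → y (inside ∷ T)) S))
    (lemma (u zero) a b _ _ _ _)
    where
    lemma : ∀ u a b x y x′ y′ →
      u * (a * x + b * y) + -1ℤ * (a * x′ + b * y′) ≡
      a * (u * x + -1ℤ * x′) + b * (u * y + -1ℤ * y′)
    lemma = solve-∀
  ∧-linear u a b x y (outside ∷ S) =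
    ∧-linear (tail u) a b (λ T → x (outside ∷ T)) (λ T → y (outside ∷ T)) S

  ∧-linearˡ : ∀ a b (u v : Vector ℤ n) x S →
    ((λ i → a * u i + b * v i) ∧ x) S ≡ a * (u ∧ x) S + b * (v ∧ x) S
  ∧-linearˡ a b u v x []            = lemma a b
    where
    lemma : ∀ a b → 0ℤ ≡ a * 0ℤ + b * 0ℤ
    lemma = solve-∀
  ∧-linearˡ a b u v x (inside ∷ S)  = trans
    (cong (λ c → (a * u zero + b * v zero) * x (outside ∷ S) + -1ℤ * c)
      (∧-linearˡ a b (tail u) (tail v) (λ T → x (inside ∷ T)) S))
    (lemma (u zero) (v zero) a b _ _ _)
    where
    lemma : ∀ u v a b x x′ y′ →
      (a * u + b * v) * x + -1ℤ * (a * x′ + b * y′) ≡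
      a * (u * x + -1ℤ * x′) + b * (v * x + -1ℤ * y′)
    lemma = solve-∀
  ∧-linearˡ a b u v x (outside ∷ S) =
    ∧-linearˡ a b (tail u) (tail v) (λ T → x (outside ∷ T)) S

  ⌟-linear : ∀ (u : Vector ℤ n) a b x y S →
    (u ⌟ λ T → a * x T + b * y T) S ≡ a * (u ⌟ x) S + b * (u ⌟ y) S
  ⌟-linear u a b x y []            = lemma a b
    where
    lemma : ∀ a b → 0ℤ ≡ a * 0ℤ + b * 0ℤ
    lemma = solve-∀
  ⌟-linear u a b x y (inside ∷ S)  = trans
    (cong (-1ℤ *_)
      (⌟-linear (tail u) a b (λ T → x (inside ∷ T)) (λ T → y (inside ∷ T)) S))
    (lemma a b _ _)
    where
    lemma : ∀ a b x y → -1ℤ * (a * x + b * y) ≡ a * (-1ℤ * x) + b * (-1ℤ * y)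
    lemma = solve-∀
  ⌟-linear u a b x y (outside ∷ S) = trans
    (cong (λ c → u zero * (a * x (inside ∷ S) + b * y (inside ∷ S)) + 1ℤ * c)
      (⌟-linear (tail u) a b (λ T → x (outside ∷ T)) (λ T → y (outside ∷ T)) S))
    (lemma (u zero) a b _ _ _ _)
    where
    lemma : ∀ u a b x y x′ y′ →
      u * (a * x + b * y) + 1ℤ * (a * x′ + b * y′) ≡
      a * (u * x + 1ℤ * x′) + b * (u * y + 1ℤ * y′)
    lemma = solve-∀

  ⟪⟫-comm : ∀ (x y : Form n) → ⟪ x , y ⟫ ≡ ⟪ y , x ⟫
  ⟪⟫-comm {zero}  x y = ℤ.*-comm (x []) (y [])
  ⟪⟫-comm {suc n} x y = cong₂ _+_ (⟪⟫-comm {n} _ _) (⟪⟫-comm {n} _ _)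

  ⟪⟫-linearˡ : ∀ a b (x y z : Form n) →
    ⟪ (λ S → a * x S + b * y S) , z ⟫ ≡ a * ⟪ x , z ⟫ + b * ⟪ y , z ⟫
  ⟪⟫-linearˡ {zero}  a b x y z = lemma a b (x []) (y []) (z [])
    where
    lemma : ∀ a b x y z → (a * x + b * y) * z ≡ a * (x * z) + b * (y * z)
    lemma = solve-∀
  ⟪⟫-linearˡ {suc n} a b x y z = trans
    (cong₂ _+_ (⟪⟫-linearˡ {n} a b _ _ _) (⟪⟫-linearˡ {n} a b _ _ _))
    (lemma a b _ _ _ _)
    where
    lemma : ∀ a b x y x′ y′ →
      (a * x + b * y) + (a * x′ + b * y′) ≡ a * (x + x′) + b * (y + y′)
    lemma = solve-∀

  ⟪⟫-linearʳ : ∀ a b (z x y : Form n) →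
    ⟪ z , (λ S → a * x S + b * y S) ⟫ ≡ a * ⟪ z , x ⟫ + b * ⟪ z , y ⟫
  ⟪⟫-linearʳ a b z x y = trans (⟪⟫-comm z _) (trans (⟪⟫-linearˡ a b x y z)
    (cong₂ (λ c d → a * c + b * d) (⟪⟫-comm x z) (⟪⟫-comm y z)))

  private
    -- Scaling is the two-term linearity with second coefficient zero.
    +0* : ∀ a i → a * i ≡ a * i + 0ℤ * i
    +0* = solve-∀

  ∧-* : ∀ (u : Vector ℤ n) a x S → (u ∧ λ T → a * x T) S ≡ a * (u ∧ x) S
  ∧-* u a x S = trans (∧-congˡ u (λ T → +0* a (x T)) S)
    (trans (∧-linear u a 0ℤ x x S) (sym (+0* a _)))

  ⟪⟫-*ˡ : ∀ a (x y : Form n) → ⟪ (λ S → a * x S) , y ⟫ ≡ a * ⟪ x , y ⟫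
  ⟪⟫-*ˡ a x y = trans (⟪⟫-cong {y = y} (λ S → +0* a (x S)) (λ _ → refl))
    (trans (⟪⟫-linearˡ a 0ℤ x x y) (sym (+0* a _)))

  ⟪⟫-*ʳ : ∀ a (x y : Form n) → ⟪ x , (λ S → a * y S) ⟫ ≡ a * ⟪ x , y ⟫
  ⟪⟫-*ʳ a x y =
    trans (⟪⟫-comm x _) (trans (⟪⟫-*ˡ a y x) (cong (a *_) (⟪⟫-comm y x)))

  ⟪∧⟫≡⟪⌟⟫ : ∀ (u : Vector ℤ n) x y → ⟪ u ∧ x , y ⟫ ≡ ⟪ x , u ⌟ y ⟫
  ⟪∧⟫≡⟪⌟⟫ {zero}  u x y = sym (ℤ.*-zeroʳ (x []))
  ⟪∧⟫≡⟪⌟⟫ {suc n} u x y = trans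
    (cong₂ _+_
      (trans (⟪⟫-linearˡ (u zero) -1ℤ x₁ (tail u ∧ x₀) y₀)
        (cong (λ c → u zero * ⟪ x₁ , y₀ ⟫ + -1ℤ * c) (⟪∧⟫≡⟪⌟⟫ (tail u) x₀ y₀)))
      (⟪∧⟫≡⟪⌟⟫ (tail u) x₁ y₁))
    (trans (lemma (u zero) ⟪ x₁ , y₀ ⟫ ⟪ x₀ , tail u ⌟ y₀ ⟫ ⟪ x₁ , tail u ⌟ y₁ ⟫)
      (sym (cong₂ _+_
        (⟪⟫-*ʳ -1ℤ x₀ (tail u ⌟ y₀))
        (⟪⟫-linearʳ (u zero) 1ℤ x₁ y₀ (tail u ⌟ y₁)))))
    where
    x₀ x₁ y₀ y₁ : Form n
    x₀ S = x (inside ∷ S)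
    x₁ S = x (outside ∷ S)
    y₀ S = y (inside ∷ S)
    y₁ S = y (outside ∷ S)
    lemma : ∀ u a b c → u * a + -1ℤ * b + c ≡ -1ℤ * b + (u * a + 1ℤ * c)
    lemma = solve-∀

  -- The canonical anticommutation relation. The mixed terms, in `tail u ⌟ x₁` or `tail v ∧ x₀`,
  -- occur twice with opposite signs; what remains is `u zero * v zero` and the relation for the
  -- tails.
  ⌟-∧ : ∀ (u v : Vector ℤ n) x S → (u ⌟ v ∧ x) S + (v ∧ u ⌟ x) S ≡ u · v * x S
  ⌟-∧ u v x []            = refl
  ⌟-∧ u v x (inside ∷ S)  = trans
    (cong₂ (λ a b → -1ℤ * a + (v zero * (u zero * x₀ S + 1ℤ * (tail u ⌟ x₁) S) + -1ℤ * b))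
      (⌟-linear (tail u) (v zero) -1ℤ x₁ (tail v ∧ x₀) S)
      (∧-* (tail v) -1ℤ (tail u ⌟ x₀) S))
    (trans (lemma (u zero) (v zero) (x₀ S) _ _ _)
     (trans (cong (λ c → u zero * v zero * x₀ S + c) (⌟-∧ (tail u) (tail v) x₀ S))
       (sym (ℤ.*-distribʳ-+ (x₀ S) (u zero * v zero) (tail u · tail v)))))
    where
    x₀ x₁ : Form _
    x₀ S = x (inside ∷ S)
    x₁ S = x (outside ∷ S)
    lemma : ∀ u v x a b c →
      -1ℤ * (v * a + -1ℤ * b) + (v * (u * x + 1ℤ * a) + -1ℤ * (-1ℤ * c)) ≡
      u * v * x + (b + c)
    lemma = solve-∀
  ⌟-∧ u v x (outside ∷ S) = trans
    (cong (λ a → u zero * (v zero * x₁ S + -1ℤ * (tail v ∧ x₀) S) + 1ℤ * (tail u ⌟ tail v ∧ x₁) S + a)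
      (∧-linear (tail v) (u zero) 1ℤ x₀ (tail u ⌟ x₁) S))
    (trans (lemma (u zero) (v zero) (x₁ S) _ _ _)
     (trans (cong (λ c → u zero * v zero * x₁ S + c) (⌟-∧ (tail u) (tail v) x₁ S))
       (sym (ℤ.*-distribʳ-+ (x₁ S) (u zero * v zero) (tail u · tail v)))))
    where
    x₀ x₁ : Form _
    x₀ S = x (inside ∷ S)
    x₁ S = x (outside ∷ S)
    lemma : ∀ u v x a b c →
      u * (v * x + -1ℤ * a) + 1ℤ * b + (u * a + 1ℤ * c) ≡ u * v * x + (b + c)
    lemma = solve-∀

  ∧-∧-self : ∀ (u : Vector ℤ n) x S → (u ∧ u ∧ x) S ≡ 0ℤ
  ∧-∧-self u x []            = refl
  ∧-∧-self u x (inside ∷ S)  = trans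
    (cong (λ a → u zero * (tail u ∧ x₁) S + -1ℤ * a)
      (∧-linear (tail u) (u zero) -1ℤ x₁ (tail u ∧ x₀) S))
    (trans (lemma (u zero) _ _) (∧-∧-self (tail u) x₀ S))
    where
    x₀ x₁ : Form _
    x₀ S = x (inside ∷ S)
    x₁ S = x (outside ∷ S)
    lemma : ∀ u a b → u * a + -1ℤ * (u * a + -1ℤ * b) ≡ b
    lemma = solve-∀
  ∧-∧-self u x (outside ∷ S) = ∧-∧-self (tail u) (λ T → x (outside ∷ T)) S

  ∧-anticomm : ∀ (u v : Vector ℤ n) x S → (u ∧ v ∧ x) S ≡ -1ℤ * (v ∧ u ∧ x) S
  ∧-anticomm u v x []            = refl
  ∧-anticomm u v x (inside ∷ S)  = trans
    (cong (λ a → u zero * (tail v ∧ x₁) S + -1ℤ * a)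
      (trans (∧-linear (tail u) (v zero) -1ℤ x₁ (tail v ∧ x₀) S)
        (cong (λ a → v zero * (tail u ∧ x₁) S + -1ℤ * a) (∧-anticomm (tail u) (tail v) x₀ S))))
    (trans (lemma (u zero) (v zero) _ _ _)
      (cong (λ a → -1ℤ * (v zero * (tail u ∧ x₁) S + -1ℤ * a))
        (sym (∧-linear (tail v) (u zero) -1ℤ x₁ (tail u ∧ x₀) S))))
    where
    x₀ x₁ : Form _
    x₀ S = x (inside ∷ S)
    x₁ S = x (outside ∷ S)
    lemma : ∀ u v a b c →
      u * a + -1ℤ * (v * b + -1ℤ * (-1ℤ * c)) ≡ -1ℤ * (v * b + -1ℤ * (u * a + -1ℤ * c))
    lemma = solve-∀
  ∧-anticomm u v x (outside ∷ S) = ∧-anticomm (tail u) (tail v) (λ T → x (outside ∷ T)) S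

  -- Vanishing forms, positivity and the norm identity

  infix 4 _≗0
  _≗0 : Form n → Set
  x ≗0 = ∀ S → x S ≡ 0ℤ

  ∧-≗0 : ∀ (u : Vector ℤ n) {x} → x ≗0 → u ∧ x ≗0
  ∧-≗0 u {x} x≗0 S = trans (∧-congˡ u x≗0 S) (∧-* u 0ℤ (λ _ → 0ℤ) S)

  ⟪⟫-≗0ˡ : ∀ {x : Form n} → x ≗0 → ∀ y → ⟪ x , y ⟫ ≡ 0ℤ
  ⟪⟫-≗0ˡ {x = x} x≗0 y =
    trans (⟪⟫-cong {y = y} x≗0 (λ _ → refl)) (⟪⟫-*ˡ 0ℤ (λ _ → 0ℤ) y)

  ∥_∥² : Form n → ℤ
  ∥ x ∥² = ⟪ x , x ⟫

  0≤i*i : ∀ i → 0ℤ ≤ i * i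
  0≤i*i (+ zero)  = +≤+ z≤n
  0≤i*i (+ suc _) = +≤+ z≤n
  0≤i*i -[1+ _ ]  = +≤+ z≤n

  i+j≡0⇒i≡0 : ∀ {i j} → 0ℤ ≤ i → 0ℤ ≤ j → i + j ≡ 0ℤ → i ≡ 0ℤ
  i+j≡0⇒i≡0 {+ zero} {+ _} _ _ _ = refl

  0≤∥∥² : ∀ (x : Form n) → 0ℤ ≤ ∥ x ∥²
  0≤∥∥² {zero}  x = 0≤i*i (x [])
  0≤∥∥² {suc n} x = ℤ.+-mono-≤ (0≤∥∥² {n} _) (0≤∥∥² {n} _)

  ∥∥²≡0⇒≗0 : ∀ (x : Form n) → ∥ x ∥² ≡ 0ℤ → x ≗0
  ∥∥²≡0⇒≗0 x p []            = [ id , id ]′ (ℤ.i*j≡0⇒i≡0∨j≡0 (x []) p)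
  ∥∥²≡0⇒≗0 x p (inside ∷ S)  =
    ∥∥²≡0⇒≗0 _ (i+j≡0⇒i≡0 (0≤∥∥² (x ∘ (inside ∷_))) (0≤∥∥² (x ∘ (outside ∷_))) p) S
  ∥∥²≡0⇒≗0 x p (outside ∷ S) =
    ∥∥²≡0⇒≗0 _ (i+j≡0⇒i≡0 (0≤∥∥² (x ∘ (outside ∷_))) (0≤∥∥² (x ∘ (inside ∷_)))
      (trans (ℤ.+-comm _ ∥ x ∘ (inside ∷_) ∥²) p)) S

  ⌟-∧′ : ∀ (u v : Vector ℤ n) x S →
    (u ⌟ v ∧ x) S ≡ u · v * x S + -1ℤ * (v ∧ u ⌟ x) S
  ⌟-∧′ u v x S = trans (lemma _ _)
    (cong (_+ -1ℤ * (v ∧ u ⌟ x) S) (⌟-∧ u v x S))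
    where
    lemma : ∀ a b → a ≡ a + b + -1ℤ * b
    lemma = solve-∀

  ∥∧∥²+∥⌟∥² : ∀ (u : Vector ℤ n) x → ∥ u ∧ x ∥² + ∥ u ⌟ x ∥² ≡ u · u * ∥ x ∥²
  ∥∧∥²+∥⌟∥² u x = trans (cong (_+ ∥ u ⌟ x ∥²) eq) (lemma _ _)
    where
    eq : ∥ u ∧ x ∥² ≡ u · u * ∥ x ∥² + -1ℤ * ∥ u ⌟ x ∥²
    eq = begin
      ⟪ u ∧ x , u ∧ x ⟫
        ≡⟨ ⟪∧⟫≡⟪⌟⟫ u x (u ∧ x) ⟩
      ⟪ x , u ⌟ u ∧ x ⟫
        ≡⟨ ⟪⟫-cong {x = x} (λ _ → refl) (⌟-∧′ u u x) ⟩
      ⟪ x , (λ S → u · u * x S + -1ℤ * (u ∧ u ⌟ x) S) ⟫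
        ≡⟨ ⟪⟫-linearʳ (u · u) -1ℤ x x (u ∧ u ⌟ x) ⟩
      u · u * ∥ x ∥² + -1ℤ * ⟪ x , u ∧ u ⌟ x ⟫
        ≡⟨ cong (λ a → u · u * ∥ x ∥² + -1ℤ * a)
            (trans (⟪⟫-comm x _) (⟪∧⟫≡⟪⌟⟫ u (u ⌟ x) x)) ⟩
      u · u * ∥ x ∥² + -1ℤ * ∥ u ⌟ x ∥²
        ∎
      where open ≡-Reasoning
    lemma : ∀ a b → a + -1ℤ * b + b ≡ a
    lemma = solve-∀

  unit : Form n
  unit []            = 1ℤ
  unit (inside ∷ S)  = 0ℤ
  unit (outside ∷ S) = unit S

  ⌟-unit : ∀ (u : Vector ℤ n) → u ⌟ unit ≗0
  ⌟-unit u []            = refl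
  ⌟-unit u (inside ∷ S)  = cong (-1ℤ *_) (⌟-0 (tail u) S)
    where
    ⌟-0 : ∀ {n} (u : Vector ℤ n) → (u ⌟ λ _ → 0ℤ) ≗0
    ⌟-0 u S = ⌟-linear u 0ℤ 0ℤ (λ _ → 0ℤ) (λ _ → 0ℤ) S
  ⌟-unit u (outside ∷ S) = cong₂ (λ a b → a + 1ℤ * b) (ℤ.*-zeroʳ (u zero)) (⌟-unit (tail u) S)

  ∥unit∥² : ∀ n → ∥ unit {n} ∥² ≡ 1ℤ
  ∥unit∥² zero    = refl
  ∥unit∥² (suc n) = cong₂ _+_ (⟪⟫-≗0ˡ {n} (λ _ → refl) (λ _ → 0ℤ)) (∥unit∥² n)

  ⋀ : Matrix ℤ m n → Form n
  ⋀ {zero}  B = unit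
  ⋀ {suc m} B = B zero ∧ ⋀ (tail B)

  -- Hadamard's inequality and its equality case

  RowNorms : ℤ → Matrix ℤ m n → Set
  RowNorms c B = ∀ i → B i · B i ≡ c

  Orthogonal : Matrix ℤ m n → Set
  Orthogonal B = ∀ i j → i ≢ j → B i · B j ≡ 0ℤ

  Orthogonal-tail : ∀ (B : Matrix ℤ (suc m) n) → Orthogonal B → Orthogonal (tail B)
  Orthogonal-tail B orth i j i≢j = orth (suc i) (suc j) λ { refl → i≢j refl }

  -- Contraction moves past one row at a time: the scalar left behind is zero, and the rest vanishes
  -- by induction, ending at `unit`, whose degree cannot be lowered.
  ⌟-⋀-≗0 : ∀ (u : Vector ℤ n) (B : Matrix ℤ m n) → (∀ i → u · B i ≡ 0ℤ) → u ⌟ ⋀ B ≗0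
  ⌟-⋀-≗0 {m = zero}  u B u⊥B S = ⌟-unit u S
  ⌟-⋀-≗0 {m = suc m} u B u⊥B S = trans (⌟-∧′ u (B zero) (⋀ (tail B)) S)
    (cong₂ (λ a b → a * ⋀ (tail B) S + -1ℤ * b) (u⊥B zero)
      (∧-≗0 (B zero) (⌟-⋀-≗0 u (tail B) (λ i → u⊥B (suc i))) S))

  module _ {p : ℕ} where

    private
      -- A positive squared row length, so that it can be cancelled and its powers are nonzero.
      c : ℤ
      c = +[1+ p ]

    c^m≢0 : ∀ m → c ^ m ≢ 0ℤ
    c^m≢0 m eq = contradiction (ℤ.i^n≡0⇒i≡0 c m eq) λ ()

    -- Each row multiplies the squared norm by `c`, up to the loss `∥ b ⌟ W ∥²`, which is dropped.
    ∥⋀∥²≤ : ∀ (B : Matrix ℤ m n) → RowNorms c B → ∥ ⋀ B ∥² ≤ c ^ m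
    ∥⋀∥²≤ {zero} {n} B norms = ℤ.≤-reflexive (∥unit∥² n)
    ∥⋀∥²≤ {suc m}    B norms = begin
      ∥ b ∧ W ∥²                ≡⟨ ℤ.+-identityʳ _ ⟨
      ∥ b ∧ W ∥² + 0ℤ           ≤⟨ ℤ.+-monoʳ-≤ ∥ b ∧ W ∥² (0≤∥∥² (b ⌟ W)) ⟩
      ∥ b ∧ W ∥² + ∥ b ⌟ W ∥²   ≡⟨ ∥∧∥²+∥⌟∥² b W ⟩
      b · b * ∥ W ∥²            ≡⟨ cong (_* ∥ W ∥²) (norms zero) ⟩
      c * ∥ W ∥²                ≤⟨ ℤ.*-monoˡ-≤-nonNeg c (∥⋀∥²≤ (tail B) (λ i → norms (suc i))) ⟩
      c * c ^ m                 ∎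
      where
      open ℤ.≤-Reasoning
      b = B zero
      W = ⋀ (tail B)

    Orthogonal⇒∥⋀∥²≡ : ∀ (B : Matrix ℤ m n) → RowNorms c B → Orthogonal B → ∥ ⋀ B ∥² ≡ c ^ m
    Orthogonal⇒∥⋀∥²≡ {zero} {n} B norms orth = ∥unit∥² n
    Orthogonal⇒∥⋀∥²≡ {suc m}    B norms orth = begin
      ∥ b ∧ W ∥²                ≡⟨ ℤ.+-identityʳ _ ⟨
      ∥ b ∧ W ∥² + 0ℤ           ≡⟨ cong (λ a → ∥ b ∧ W ∥² + a)
        (⟪⟫-≗0ˡ (⌟-⋀-≗0 b (tail B) (λ i → orth zero (suc i) λ ())) (b ⌟ W)) ⟨
      ∥ b ∧ W ∥² + ∥ b ⌟ W ∥²   ≡⟨ ∥∧∥²+∥⌟∥² b W ⟩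
      b · b * ∥ W ∥²            ≡⟨ cong₂ _*_ (norms zero)
        (Orthogonal⇒∥⋀∥²≡ (tail B) (λ i → norms (suc i)) (Orthogonal-tail B orth)) ⟩
      c * c ^ m                 ∎
      where
      open ≡-Reasoning
      b = B zero
      W = ⋀ (tail B)

    -- With B = b ∷ B′, W = ⋀ B′ and y = u ⌟ W, the hypothesis reads
    -- b ∧ y ≗ (u · b) W. Pairing with b ∧ y gives b ∧ y ≗ 0, because b ⌟ W ≗ 0;
    -- hence u · b ≡ 0 and, as also b ⌟ y ≗ 0, the norm identity gives y ≗ 0.
    ⌟-⋀-≗0⁻ : ∀ (u : Vector ℤ n) (B : Matrix ℤ m n) → RowNorms c B → Orthogonal B →
              u ⌟ ⋀ B ≗0 → ∀ i → u · B i ≡ 0ℤ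
    ⌟-⋀-≗0⁻ {n} {suc m} u B norms orth u⌟⋀B≗0 = λ where
        zero    → u·b≡0
        (suc i) → ⌟-⋀-≗0⁻ u (tail B) (λ i → norms (suc i)) (Orthogonal-tail B orth) y≗0 i
      where
      open ≡-Reasoning
      b = B zero
      W y : Form n
      W = ⋀ (tail B)
      y = u ⌟ W

      b⌟W≗0 : b ⌟ W ≗0
      b⌟W≗0 = ⌟-⋀-≗0 b (tail B) (λ i → orth zero (suc i) λ ())

      b∧y≗ : ∀ S → (b ∧ y) S ≡ u · b * W S
      b∧y≗ S = begin
        (b ∧ y) S                        ≡⟨ ℤ.+-identityˡ _ ⟨
        0ℤ + (b ∧ y) S                   ≡⟨ cong (_+ (b ∧ y) S) (u⌟⋀B≗0 S) ⟨
        (u ⌟ b ∧ W) S + (b ∧ y) S        ≡⟨ ⌟-∧ u b W S ⟩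
        u · b * W S                      ∎

      b∧y≗0 : b ∧ y ≗0
      b∧y≗0 = ∥∥²≡0⇒≗0 (b ∧ y) (begin
        ⟪ b ∧ y , b ∧ y ⟫              ≡⟨ ⟪⟫-cong {y = b ∧ y} b∧y≗ (λ _ → refl) ⟩
        ⟪ (λ S → u · b * W S) , b ∧ y ⟫ ≡⟨ ⟪⟫-*ˡ (u · b) W (b ∧ y) ⟩
        u · b * ⟪ W , b ∧ y ⟫          ≡⟨ cong (u · b *_)
          (trans (⟪⟫-comm W (b ∧ y)) (trans (⟪∧⟫≡⟪⌟⟫ b y W) (trans (⟪⟫-comm y (b ⌟ W)) (⟪⟫-≗0ˡ b⌟W≗0 y)))) ⟩
        u · b * 0ℤ                     ≡⟨ ℤ.*-zeroʳ (u · b) ⟩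
        0ℤ                             ∎)

      u·b≡0 : u · b ≡ 0ℤ
      -- `W` cannot have norm zero: its rows are orthogonal, so `∥ W ∥²` is `c ^ m`.
      u·b≡0 = [ id , (λ p → contradiction (trans (sym ∥W∥²≡) p) (c^m≢0 m)) ]′
        (ℤ.i*j≡0⇒i≡0∨j≡0 (u · b) (begin
          u · b * ∥ W ∥²               ≡⟨ ⟪⟫-*ˡ (u · b) W W ⟨
          ⟪ (λ S → u · b * W S) , W ⟫  ≡⟨ ⟪⟫-≗0ˡ (λ S → trans (sym (b∧y≗ S)) (b∧y≗0 S)) W ⟩
          0ℤ                           ∎))
        where
        ∥W∥²≡ = Orthogonal⇒∥⋀∥²≡ (tail B) (λ i → norms (suc i)) (Orthogonal-tail B orth)

      -- Contractions anticommute, so `b ⌟ u ⌟ W` is minus `u ⌟ b ⌟ W`, which is zero. Adjunction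
      -- carries this back to the anticommutativity of wedging.
      ∥b⌟y∥²≡0 : ∥ b ⌟ y ∥² ≡ 0ℤ
      ∥b⌟y∥²≡0 = begin
        ⟪ b ⌟ y , b ⌟ y ⟫              ≡⟨ ⟪∧⟫≡⟪⌟⟫ b (b ⌟ y) y ⟨
        ⟪ b ∧ b ⌟ y , u ⌟ W ⟫          ≡⟨ ⟪∧⟫≡⟪⌟⟫ u (b ∧ b ⌟ y) W ⟨
        ⟪ u ∧ b ∧ b ⌟ y , W ⟫          ≡⟨ ⟪⟫-cong {y = W} (∧-anticomm u b (b ⌟ y)) (λ _ → refl) ⟩
        ⟪ (λ S → -1ℤ * (b ∧ u ∧ b ⌟ y) S) , W ⟫ ≡⟨ ⟪⟫-*ˡ -1ℤ (b ∧ u ∧ b ⌟ y) W ⟩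
        -1ℤ * ⟪ b ∧ u ∧ b ⌟ y , W ⟫    ≡⟨ cong (-1ℤ *_) (⟪∧⟫≡⟪⌟⟫ b (u ∧ b ⌟ y) W) ⟩
        -1ℤ * ⟪ u ∧ b ⌟ y , b ⌟ W ⟫    ≡⟨ cong (-1ℤ *_)
          (trans (⟪⟫-comm (u ∧ b ⌟ y) (b ⌟ W)) (⟪⟫-≗0ˡ b⌟W≗0 (u ∧ b ⌟ y))) ⟩
        0ℤ                             ∎

      y≗0 : y ≗0
      y≗0 = ∥∥²≡0⇒≗0 y (ℤ.*-cancelˡ-≡ c ∥ y ∥² 0ℤ (begin
        c * ∥ y ∥²                     ≡⟨ cong (_* ∥ y ∥²) (norms zero) ⟨
        b · b * ∥ y ∥²                 ≡⟨ ∥∧∥²+∥⌟∥² b y ⟨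
        ∥ b ∧ y ∥² + ∥ b ⌟ y ∥²        ≡⟨ cong₂ _+_ (⟪⟫-≗0ˡ b∧y≗0 (b ∧ y)) ∥b⌟y∥²≡0 ⟩
        0ℤ                             ≡⟨ ℤ.*-zeroʳ c ⟨
        c * 0ℤ                         ∎))

    -- Equality leaves no room for a loss at any row: it forces `∥ W ∥²` up to `c ^ m`, and then
    -- `b ⌟ W` to vanish. The first makes the later rows orthogonal by induction, and this is what
    -- allows the second to be read as orthogonality of `b` to each of them.
    ∥⋀∥²≡⇒Orthogonal : ∀ (B : Matrix ℤ m n) → RowNorms c B → ∥ ⋀ B ∥² ≡ c ^ m → Orthogonal B
    ∥⋀∥²≡⇒Orthogonal {suc m} B norms eq = λ where
        zero    zero    0≢0 → contradiction refl 0≢0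
        zero    (suc j) _   → b⊥ j
        (suc i) zero    _   → trans (·-comm (B (suc i)) b) (b⊥ i)
        (suc i) (suc j) i≢j → orth i j (i≢j ∘ cong suc)
      where
      b = B zero
      W = ⋀ (tail B)

      c^[1+m]+∥b⌟W∥² : c * c ^ m + ∥ b ⌟ W ∥² ≡ c * ∥ W ∥²
      c^[1+m]+∥b⌟W∥² = trans (cong (_+ ∥ b ⌟ W ∥²) (sym eq))
        (trans (∥∧∥²+∥⌟∥² b W) (cong (_* ∥ W ∥²) (norms zero)))

      ∥W∥²≡ : ∥ W ∥² ≡ c ^ m
      ∥W∥²≡ = ℤ.≤-antisym (∥⋀∥²≤ (tail B) (λ i → norms (suc i)))
        (ℤ.*-cancelˡ-≤-pos (c ^ m) ∥ W ∥² c (begin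
          c * c ^ m                 ≡⟨ ℤ.+-identityʳ _ ⟨
          c * c ^ m + 0ℤ            ≤⟨ ℤ.+-monoʳ-≤ (c * c ^ m) (0≤∥∥² (b ⌟ W)) ⟩
          c * c ^ m + ∥ b ⌟ W ∥²    ≡⟨ c^[1+m]+∥b⌟W∥² ⟩
          c * ∥ W ∥²                ∎))
        where open ℤ.≤-Reasoning

      orth : Orthogonal (tail B)
      orth = ∥⋀∥²≡⇒Orthogonal (tail B) (λ i → norms (suc i)) ∥W∥²≡

      ∥b⌟W∥²≡0 : ∥ b ⌟ W ∥² ≡ 0ℤ
      ∥b⌟W∥²≡0 = +-cancelˡ (c * c ^ m) ∥ b ⌟ W ∥² 0ℤ
        (trans c^[1+m]+∥b⌟W∥² (trans (cong (c *_) ∥W∥²≡) (sym (ℤ.+-identityʳ _))))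

      b⊥ : ∀ i → b · B (suc i) ≡ 0ℤ
      b⊥ = ⌟-⋀-≗0⁻ b (tail B) (λ i → norms (suc i)) orth (∥∥²≡0⇒≗0 (b ⌟ W) ∥b⌟W∥²≡0)

  -- Minors as coefficients of a wedge product

  det-cong : ∀ {A B : Matrix ℤ n n} → (∀ i j → A i j ≡ B i j) → det A ≡ det B
  det-cong {zero}  A≗B = refl
  det-cong {suc n} A≗B = sum-cong-≗ λ j →
    cong₂ _*_ (cong (-1ℤ ^ toℕ j *_) (A≗B zero j)) (det-cong λ i k → A≗B (suc i) (punchIn j k))

  lookup-removeAt : ∀ {A : Set} (v : Vec A (suc n)) j k →
                    lookup (removeAt v j) k ≡ lookup v (punchIn j k)
  lookup-removeAt (x ∷ v)     zero    k       = refl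
  lookup-removeAt (x ∷ y ∷ v) (suc j) zero    = refl
  lookup-removeAt (x ∷ y ∷ v) (suc j) (suc k) = lookup-removeAt (y ∷ v) j k

  removeAt-map : ∀ {A B : Set} (f : A → B) (v : Vec A (suc n)) j →
                 removeAt (Vec.map f v) j ≡ Vec.map f (removeAt v j)
  removeAt-map f (x ∷ v)     zero    = refl
  removeAt-map f (x ∷ y ∷ v) (suc j) = cong (f x ∷_) (removeAt-map f (y ∷ v) j)

  -- The form of degree m whose coefficient at {c₁ < ⋯ < cₘ} is f (c₁ ∷ ⋯ ∷ cₘ ∷ []).
  -- The outside clause comes first so that it reduces without a case split on m.
  form : (Vec (Fin n) m → ℤ) → Form n
  form {suc n}         f (outside ∷ S) = form (f ∘ sucs) S
  form {zero}  {zero}  f []            = f []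
  form {zero}  {suc m} f []            = 0ℤ
  form {suc n} {zero}  f (inside ∷ S)  = 0ℤ
  form {suc n} {suc m} f (inside ∷ S)  = form (f ∘ zero∷_) S

  form-cong : ∀ {f g : Vec (Fin n) m → ℤ} → f ≗ g → form f ≗ form g
  form-cong {zero}  {zero}  f≗g []            = f≗g []
  form-cong {zero}  {suc m} f≗g []            = refl
  form-cong {suc n} {zero}  f≗g (inside ∷ S)  = refl
  form-cong {suc n} {suc m} f≗g (inside ∷ S)  = form-cong (f≗g ∘ zero∷_) S
  form-cong {suc n} {m}     f≗g (outside ∷ S) = form-cong (f≗g ∘ sucs) S

  form-linear : ∀ a b (f g : Vec (Fin n) m → ℤ) S →
    form (λ c → a * f c + b * g c) S ≡ a * form f S + b * form g S
  form-linear {zero}  {zero}  a b f g []            = refl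
  form-linear {zero}  {suc m} a b f g []            = lemma a b
    where
    lemma : ∀ a b → 0ℤ ≡ a * 0ℤ + b * 0ℤ
    lemma = solve-∀
  form-linear {suc n} {zero}  a b f g (inside ∷ S)  = lemma a b
    where
    lemma : ∀ a b → 0ℤ ≡ a * 0ℤ + b * 0ℤ
    lemma = solve-∀
  form-linear {suc n} {suc m} a b f g (inside ∷ S)  = form-linear a b (f ∘ zero∷_) (g ∘ zero∷_) S
  form-linear {suc n} {m}     a b f g (outside ∷ S) = form-linear a b (f ∘ sucs) (g ∘ sucs) S

  -- First-row expansion with an arbitrary function of the columns in place of the cofactors, so
  -- that it describes wedging with `u` on any form of degree `m`.
  laplace : Vector ℤ n → (Vec (Fin n) m → ℤ) → Vec (Fin n) (suc m) → ℤ
  laplace u f c = sum λ j → -1ℤ ^ toℕ j * u (lookup c j) * f (removeAt c j)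

  laplace-sucs : ∀ (u : Vector ℤ (suc n)) (f : Vec (Fin (suc n)) m → ℤ) c →
                 laplace u f (sucs c) ≡ laplace (tail u) (f ∘ sucs) c
  laplace-sucs u f c = sum-cong-≗ λ j →
    cong₂ (λ i d → -1ℤ ^ toℕ j * u i * f d) (lookup-map j suc c) (removeAt-map suc c j)

  -- Either column zero is deleted, or it stays and the deleted position lies one further on, which
  -- flips the sign. This is the `inside` clause of `_∧_`.
  laplace-zero∷ : ∀ (u : Vector ℤ (suc n)) (f : Vec (Fin (suc n)) (suc m) → ℤ) c →
    laplace u f (zero∷ c) ≡
    u zero * f (sucs c) + -1ℤ * laplace (tail u) (f ∘ zero∷_) c
  laplace-zero∷ u f c@(x ∷ d) = cong₂ _+_
    (cong (_* f (sucs c)) (ℤ.*-identityˡ (u zero)))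
    (trans (sum-cong-≗ λ j → trans
        (cong₂ (λ i d → -1ℤ ^ toℕ (suc j) * u i * f (zero ∷ d))
          (lookup-map j suc c) (removeAt-map suc c j))
        (lemma (-1ℤ ^ toℕ j) _ _))
      (sym (*-distribˡ-sum -1ℤ λ j →
        -1ℤ ^ toℕ j * tail u (lookup c j) * f (zero∷ (removeAt c j)))))
    where
    lemma : ∀ a b c → -1ℤ * a * b * c ≡ -1ℤ * (a * b * c)
    lemma = solve-∀

  ∧-form : ∀ (u : Vector ℤ n) (f : Vec (Fin n) m → ℤ) → u ∧ form f ≗ form (laplace u f)
  ∧-form u f []                      = refl
  ∧-form {suc n} {zero} u f (inside ∷ S) = begin
    u zero * form (f ∘ sucs) S + -1ℤ * (tail u ∧ λ T → 0ℤ) S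
      ≡⟨ cong (λ a → u zero * form (f ∘ sucs) S + -1ℤ * a) (∧-≗0 (tail u) (λ _ → refl) S) ⟩
    -- The vanishing term is written as a zero multiple to fit the two-term `form-linear`.
    u zero * form (f ∘ sucs) S + 0ℤ * form (f ∘ sucs) S
      ≡⟨ form-linear (u zero) 0ℤ (f ∘ sucs) (f ∘ sucs) S ⟨
    form (λ c → u zero * f (sucs c) + 0ℤ * f (sucs c)) S
      ≡⟨ form-cong (λ { [] → lemma (u zero) (f []) }) S ⟩
    form (laplace u f ∘ zero∷_) S
      ∎
    where
    open ≡-Reasoning
    lemma : ∀ u a → u * a + 0ℤ * a ≡ 1ℤ * u * a + 0ℤ
    lemma = solve-∀
  ∧-form {suc n} {suc m} u f (inside ∷ S) = begin
    u zero * form (f ∘ sucs) S + -1ℤ * (tail u ∧ form (f ∘ zero∷_)) S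
      ≡⟨ cong (λ a → u zero * form (f ∘ sucs) S + -1ℤ * a) (∧-form (tail u) (f ∘ zero∷_) S) ⟩
    u zero * form (f ∘ sucs) S + -1ℤ * form (laplace (tail u) (f ∘ zero∷_)) S
      ≡⟨ form-linear (u zero) -1ℤ (f ∘ sucs) (laplace (tail u) (f ∘ zero∷_)) S ⟨
    form (λ c → u zero * f (sucs c) + -1ℤ * laplace (tail u) (f ∘ zero∷_) c) S
      ≡⟨ form-cong (laplace-zero∷ u f) S ⟨
    form (laplace u f ∘ zero∷_) S
      ∎
    where open ≡-Reasoning
  ∧-form {suc n} u f (outside ∷ S) =
    trans (∧-form (tail u) (f ∘ sucs) S) (form-cong (λ c → sym (laplace-sucs u f c)) S)

  columns : Matrix ℤ m n → Vec (Fin n) m → Matrix ℤ m m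
  columns B c i j = B i (lookup c j)

  det-columns : ∀ (B : Matrix ℤ (suc m) n) c →
                det (columns B c) ≡ laplace (B zero) (det ∘ columns (tail B)) c
  det-columns B c = sum-cong-≗ λ j →
    cong (-1ℤ ^ toℕ j * B zero (lookup c j) *_)
      (det-cong λ i k → cong (B (suc i)) (sym (lookup-removeAt c j k)))

  ⋀≗form : ∀ (B : Matrix ℤ m n) → ⋀ B ≗ form (det ∘ columns B)
  ⋀≗form {zero}  B = unit≗form
    where
    unit≗form : ∀ {n} → unit ≗ form {n} {0} (λ _ → 1ℤ)
    unit≗form []            = refl
    unit≗form (inside ∷ S)  = refl
    unit≗form (outside ∷ S) = unit≗form S
  ⋀≗form {suc m} B S = begin
    (B zero ∧ ⋀ (tail B)) S                             ≡⟨ ∧-congˡ (B zero) (⋀≗form (tail B)) S ⟩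
    (B zero ∧ form (det ∘ columns (tail B))) S          ≡⟨ ∧-form (B zero) _ S ⟩
    form (laplace (B zero) (det ∘ columns (tail B))) S  ≡⟨ form-cong (det-columns B) S ⟨
    form (det ∘ columns B) S                            ∎
    where open ≡-Reasoning

  Σ : ∀ {A : Set} → (A → ℤ) → List A → ℤ
  Σ f []       = 0ℤ
  Σ f (x ∷ xs) = f x + Σ f xs

  Σ-++ : ∀ {A : Set} (f : A → ℤ) xs ys → Σ f (xs ++ ys) ≡ Σ f xs + Σ f ys
  Σ-++ f []       ys = sym (ℤ.+-identityˡ _)
  Σ-++ f (x ∷ xs) ys = trans (cong (λ a → f x + a) (Σ-++ f xs ys)) (sym (ℤ.+-assoc (f x) _ _))

  Σ-map : ∀ {A B : Set} (f : B → ℤ) (g : A → B) xs → Σ f (List.map g xs) ≡ Σ (f ∘ g) xs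
  Σ-map f g []       = refl
  Σ-map f g (x ∷ xs) = cong (λ a → f (g x) + a) (Σ-map f g xs)

  -- `choices` branches on whether zero is taken, just as the inner product branches on `inside` and
  -- `outside`.
  ∥form∥² : ∀ (f : Vec (Fin n) m → ℤ) → ∥ form f ∥² ≡ Σ (λ c → f c * f c) (choices n m)
  ∥form∥² {zero}  {zero}  f = sym (ℤ.+-identityʳ _)
  ∥form∥² {zero}  {suc m} f = refl
  ∥form∥² {suc n} {zero}  f =
    trans (cong₂ _+_ (⟪⟫-≗0ˡ {n} (λ _ → refl) _) (∥form∥² {n} {0} (f ∘ sucs)))
      (ℤ.+-identityˡ _)
  ∥form∥² {suc n} {suc m} f = sym (begin
    Σ f² (choices (suc n) (suc m))
      ≡⟨ Σ-++ f² (List.map zero∷_ (choices n m)) _ ⟩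
    Σ f² (List.map zero∷_ (choices n m)) + Σ f² (List.map sucs (choices n (suc m)))
      ≡⟨ cong₂ _+_ (Σ-map f² zero∷_ (choices n m)) (Σ-map f² sucs (choices n (suc m))) ⟩
    Σ (f² ∘ zero∷_) (choices n m) + Σ (f² ∘ sucs) (choices n (suc m))
      ≡⟨ cong₂ _+_ (∥form∥² (f ∘ zero∷_)) (∥form∥² (f ∘ sucs)) ⟨
    ∥ form f ∥²
      ∎)
    where
    open ≡-Reasoning
    f² = λ c → f c * f c

  -- Determinants of sign matrices

  infix 4 _∣ᶠ_
  _∣ᶠ_ : ℤ → Form n → Set
  a ∣ᶠ x = ∀ S → a ∣ x S

  ∧-∣ : ∀ {a} (u : Vector ℤ n) x → a ∣ᶠ x → a ∣ᶠ u ∧ x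
  ∧-∣ u x a∣x []            = divides 0ℤ refl
  ∧-∣ u x a∣x (inside ∷ S)  = ∣m∣n⇒∣m+n
    (∣n⇒∣m*n (u zero) (a∣x _))
    (∣n⇒∣m*n -1ℤ (∧-∣ (tail u) _ (λ T → a∣x (inside ∷ T)) S))
  ∧-∣ u x a∣x (outside ∷ S) = ∧-∣ (tail u) _ (λ T → a∣x (outside ∷ T)) S

  2ℤ : ℤ
  2ℤ = + 2

  ones : Vector ℤ n
  ones _ = 1ℤ

  -- Let s be the all-ones row. A sign row is b = s + 2e, so b ∧ x = s ∧ x + e ∧ 2x
  -- and s ∧ b ∧ x = -2 (e ∧ s ∧ x): each row contributes a factor 2 to both 2 ⋀ B
  -- and s ∧ ⋀ B.
  2^∣⋀ : ∀ (B : Matrix ℤ m n) → SignMatrix B →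
         (2ℤ ^ m ∣ᶠ λ S → 2ℤ * ⋀ B S) × (2ℤ ^ m ∣ᶠ ones ∧ ⋀ B)
  2^∣⋀ {zero}  B signs = (λ S → 1∣ _) , (λ S → 1∣ _)
    where
    1∣ : ∀ a → 1ℤ ∣ a
    1∣ a = divides a (sym (ℤ.*-identityʳ a))
  2^∣⋀ {suc m} {n} B signs = (λ S → *-monoʳ-∣ 2ℤ (∣b∧W S)) , ∣s∧b∧W
    where
    b = B zero
    W = ⋀ (tail B)
    ih = 2^∣⋀ (tail B) (λ i → signs (suc i))
    half : ∀ {a} → a ≡ 1ℤ ⊎ a ≡ -1ℤ → ∃[ e ] a ≡ 1ℤ * 1ℤ + 2ℤ * e
    half (inj₁ refl) = 0ℤ , refl
    half (inj₂ refl) = -1ℤ , refl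
    e : Vector ℤ n
    e i = proj₁ (half (signs zero i))
    b∧ : ∀ x S → (b ∧ x) S ≡ 1ℤ * (ones ∧ x) S + 2ℤ * (e ∧ x) S
    b∧ x S = trans (∧-cong {y = x} (λ i → proj₂ (half (signs zero i))) (λ _ → refl) S)
      (∧-linearˡ 1ℤ 2ℤ ones e x S)
    ∣b∧W : 2ℤ ^ m ∣ᶠ b ∧ W
    ∣b∧W S = subst (2ℤ ^ m ∣_)
      (sym (trans (b∧ W S) (cong (λ a → 1ℤ * (ones ∧ W) S + a) (sym (∧-* e 2ℤ W S)))))
      (∣m∣n⇒∣m+n (∣n⇒∣m*n 1ℤ (proj₂ ih S)) (∧-∣ e (λ T → 2ℤ * W T) (proj₁ ih) S))
    ∣s∧b∧W : 2ℤ * 2ℤ ^ m ∣ᶠ ones ∧ b ∧ W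
    ∣s∧b∧W S = subst (2ℤ * 2ℤ ^ m ∣_) (sym eq)
      (∣n⇒∣m*n -1ℤ (*-monoʳ-∣ 2ℤ (∧-∣ e (ones ∧ W) (proj₂ ih) S)))
      where
      eq : (ones ∧ b ∧ W) S ≡ -1ℤ * (2ℤ * (e ∧ ones ∧ W) S)
      eq = trans (∧-anticomm ones b W S) (cong (-1ℤ *_) (trans (b∧ (ones ∧ W) S)
        (trans (cong (λ a → 1ℤ * a + 2ℤ * (e ∧ ones ∧ W) S) (∧-∧-self ones W S)) (ℤ.+-identityˡ _))))

  ∣∣≡1 : ∀ {a} → a ≡ 1ℤ ⊎ a ≡ -1ℤ → ∣ a ∣ ≡ 1
  ∣∣≡1 (inj₁ refl) = refl
  ∣∣≡1 (inj₂ refl) = refl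

  ∣sum∣≤ : ∀ k (t : Vector ℤ m) → (∀ i → ∣ t i ∣ ℕ.≤ k) → ∣ sum t ∣ ℕ.≤ m ℕ.* k
  ∣sum∣≤ {zero}  k t t≤k = z≤n
  ∣sum∣≤ {suc m} k t t≤k = ℕ.≤-trans (ℤ.∣i+j∣≤∣i∣+∣j∣ (t zero) _)
    (ℕ.+-mono-≤ (t≤k zero) (∣sum∣≤ k (tail t) (λ i → t≤k (suc i))))

  ∣det∣≤m! : ∀ (A : Matrix ℤ m m) → SignMatrix A → ∣ det A ∣ ℕ.≤ m !
  ∣det∣≤m! {zero}  A signs = ℕ.≤-refl
  ∣det∣≤m! {suc m} A signs = ∣sum∣≤ (m !) (λ j → -1ℤ ^ toℕ j * A zero j * D j) λ j → begin
    ∣ -1ℤ ^ toℕ j * A zero j * D j ∣           ≡⟨ ℤ.abs-* (-1ℤ ^ toℕ j * A zero j) (D j) ⟩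
    ∣ -1ℤ ^ toℕ j * A zero j ∣ ℕ.* ∣ D j ∣     ≡⟨ cong (ℕ._* ∣ D j ∣) (ℤ.abs-* (-1ℤ ^ toℕ j) (A zero j)) ⟩
    ∣ -1ℤ ^ toℕ j ∣ ℕ.* ∣ A zero j ∣ ℕ.* ∣ D j ∣ ≡⟨ cong₂ (λ a b → a ℕ.* b ℕ.* ∣ D j ∣) (∣-1^∣ (toℕ j)) (∣∣≡1 (signs zero j)) ⟩
    ∣ D j ∣ ℕ.+ 0                              ≡⟨ ℕ.+-identityʳ _ ⟩
    ∣ D j ∣                                    ≤⟨ ∣det∣≤m! _ (λ i k → signs (suc i) (punchIn j k)) ⟩
    m !                                        ∎
    where
    open ℕ.≤-Reasoning
    D = λ j → det (λ i k → A (suc i) (punchIn j k))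
    ∣-1^∣ : ∀ k → ∣ -1ℤ ^ k ∣ ≡ 1
    ∣-1^∣ zero    = refl
    ∣-1^∣ (suc k) = trans (ℤ.abs-* -1ℤ (-1ℤ ^ k)) (trans (ℕ.+-identityʳ _) (∣-1^∣ k))

  form-⊤ : ∀ (f : Vec (Fin n) n → ℤ) → form f ⊤ ≡ f (allFin n)
  form-⊤ {zero}  f = refl
  form-⊤ {suc n} f = trans (form-⊤ (f ∘ zero∷_)) (cong f (sym (allFin-map n)))

  -- The determinant is the coefficient of `⋀ A` at the full subset. The extra factor 2, which let
  -- the induction start from the empty wedge, is cancelled here.
  2^∣det : ∀ (A : Matrix ℤ (suc m) (suc m)) → SignMatrix A → 2ℤ ^ m ∣ det A
  2^∣det {m} A signs = subst (2ℤ ^ m ∣_) eq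
    (*-cancelˡ-∣ 2ℤ (proj₁ (2^∣⋀ A signs) ⊤))
    where
    eq : ⋀ A ⊤ ≡ det A
    eq = trans (⋀≗form A ⊤) (trans (form-⊤ (det ∘ columns A))
      (det-cong λ i j → cong (A i) (lookup-allFin j)))

  4^≡ : ∀ m → 2ℤ ^ m * 2ℤ ^ m ≡ + (4 ℕ.^ m)
  4^≡ zero    = refl
  4^≡ (suc m) = trans (lemma (2ℤ ^ m)) (trans (cong (λ a → + 4 * a) (4^≡ m)) (sym (ℤ.pos-* 4 (4 ℕ.^ m))))
    where
    lemma : ∀ a → 2ℤ * a * (2ℤ * a) ≡ + 4 * (a * a)
    lemma = solve-∀

  [q2^m]² : ∀ q m → q * 2ℤ ^ m * (q * 2ℤ ^ m) ≡ q * q * + (4 ℕ.^ m)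
  [q2^m]² q m = trans (lemma q (2ℤ ^ m)) (cong (q * q *_) (4^≡ m))
    where
    lemma : ∀ q a → q * a * (q * a) ≡ q * q * (a * a)
    lemma = solve-∀

  1≤q² : ∀ {q} → q ≢ 0ℤ → 1ℤ ≤ q * q
  1≤q² {+ zero}   q≢0 = contradiction refl q≢0
  1≤q² {+[1+ q ]} _   = +≤+ (s≤s z≤n)
  1≤q² { -[1+ q ]} _  = +≤+ (s≤s z≤n)

  2^∣⇒≡0⊎4^≤ : ∀ {d} → 2ℤ ^ m ∣ d → d ≡ 0ℤ ⊎ + (4 ℕ.^ m) ≤ d * d
  2^∣⇒≡0⊎4^≤ {m} {d} (divides q eq) with q ℤ.≟ 0ℤ
  ... | yes refl = inj₁ eq
  ... | no q≢0   = inj₂ (begin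
    + (4 ℕ.^ m)              ≡⟨ ℤ.*-identityˡ _ ⟨
    1ℤ * + (4 ℕ.^ m)         ≤⟨ ℤ.*-monoʳ-≤-nonNeg (+ (4 ℕ.^ m)) (1≤q² q≢0) ⟩
    q * q * + (4 ℕ.^ m)      ≡⟨ [q2^m]² q m ⟨
    q * 2ℤ ^ m * (q * 2ℤ ^ m) ≡⟨ cong₂ _*_ eq eq ⟨
    d * d                    ∎)
    where open ℤ.≤-Reasoning

  ∣q∣<2⇒ : ∀ q → ∣ q ∣ ℕ.< 2 → q ≡ 0ℤ ⊎ q * q ≡ 1ℤ
  ∣q∣<2⇒ (+ 0)          _ = inj₁ refl
  ∣q∣<2⇒ (+ 1)          _ = inj₂ refl
  ∣q∣<2⇒ (-[1+ 0 ])     _ = inj₂ refl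
  ∣q∣<2⇒ (+ suc (suc _)) (s≤s (s≤s ()))
  ∣q∣<2⇒ (-[1+ suc _ ]) (s≤s (s≤s ()))

  -- The source of the restriction to orders up to 3: the comparisons are 1 < 2, 2 < 4 and 6 < 8,
  -- but at order 4 it would be 24 against 16. So the quotient of a determinant by `2ℤ ^ m` is 0, 1
  -- or -1.
  m!<2^ : suc m ℕ.≤ 3 → suc m ! ℕ.< 2 ℕ.* ∣ 2ℤ ^ m ∣
  m!<2^ {0} _ = ℕ.m≤m+n 2 0
  m!<2^ {1} _ = ℕ.m≤m+n 3 1
  m!<2^ {2} _ = ℕ.m≤m+n 7 1
  m!<2^ {suc (suc (suc _))} (s≤s (s≤s (s≤s ())))

  2^∣⇒≡0⊎≡4^ : ∀ {d} → suc m ℕ.≤ 3 → ∣ d ∣ ℕ.≤ suc m ! → 2ℤ ^ m ∣ d →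
               d ≡ 0ℤ ⊎ d * d ≡ + (4 ℕ.^ m)
  2^∣⇒≡0⊎≡4^ {m} {d} m≤3 d≤ (divides q eq) =
    Sum.map (λ { refl → eq })
      (λ q²≡1 → trans (cong₂ _*_ eq eq) (trans ([q2^m]² q m)
        (trans (cong (_* + (4 ℕ.^ m)) q²≡1) (ℤ.*-identityˡ _))))
      (∣q∣<2⇒ q (ℕ.*-cancelʳ-< ∣ 2ℤ ^ m ∣ ∣ q ∣ 2 (begin-strict
        ∣ q ∣ ℕ.* ∣ 2ℤ ^ m ∣   ≡⟨ ℤ.abs-* q (2ℤ ^ m) ⟨
        ∣ q * 2ℤ ^ m ∣         ≡⟨ cong ∣_∣ eq ⟨
        ∣ d ∣                  ≤⟨ d≤ ⟩
        suc m !                <⟨ m!<2^ m≤3 ⟩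
        2 ℕ.* ∣ 2ℤ ^ m ∣       ∎)))
    where open ℕ.≤-Reasoning

  -- Counting minors

  nonzero : List ℤ → List ℤ
  nonzero = filter (λ d → ¬? (d ℤ.≟ 0ℤ))

  suc-* : ∀ k q → + suc k * q ≡ q + + k * q
  suc-* k q = trans (cong (_* q) (ℤ.pos-+ 1 k)) (lemma (+ k) q)
    where
    lemma : ∀ k q → (1ℤ + k) * q ≡ q + k * q
    lemma = solve-∀

  count-nonzero-≤ : ∀ {q ds} → All (λ d → d ≡ 0ℤ ⊎ q ≤ d * d) ds →
    + length (nonzero ds) * q ≤ Σ (λ d → d * d) ds
  count-nonzero-≤ []                  = ℤ.≤-refl
  count-nonzero-≤ {q} {d ∷ ds} (p ∷ ps) with d ℤ.≟ 0ℤ | p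
  ... | yes refl | _        = ℤ.≤-trans (count-nonzero-≤ ps) (ℤ.≤-reflexive (sym (ℤ.+-identityˡ _)))
  ... | no d≢0   | inj₁ d≡0 = contradiction d≡0 d≢0
  ... | no _     | inj₂ q≤  =
    ℤ.≤-trans (ℤ.≤-reflexive (suc-* (length (nonzero ds)) q)) (ℤ.+-mono-≤ q≤ (count-nonzero-≤ ps))

  count-nonzero-≡ : ∀ {q ds} → All (λ d → d ≡ 0ℤ ⊎ d * d ≡ q) ds →
    + length (nonzero ds) * q ≡ Σ (λ d → d * d) ds
  count-nonzero-≡ []                  = refl
  count-nonzero-≡ {q} {d ∷ ds} (p ∷ ps) with d ℤ.≟ 0ℤ | p
  ... | yes refl | _        = trans (count-nonzero-≡ ps) (sym (ℤ.+-identityˡ _))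
  ... | no d≢0   | inj₁ d≡0 = contradiction d≡0 d≢0
  ... | no _     | inj₂ ≡q  =
    trans (suc-* (length (nonzero ds)) q) (cong₂ _+_ (sym ≡q) (count-nonzero-≡ ps))

  module _ {X : Set} {f : X → ℤ} {c : ℤ} where

    Σ-≤ : ∀ {xs} → All (λ x → f x ≤ c) xs → Σ f xs ≤ + length xs * c
    Σ-≤ []                = ℤ.≤-refl
    Σ-≤ {x ∷ xs} (p ∷ ps) =
      ℤ.≤-trans (ℤ.+-mono-≤ p (Σ-≤ ps)) (ℤ.≤-reflexive (sym (suc-* (length xs) c)))

    Σ-≡ : ∀ {xs} → All (λ x → f x ≡ c) xs → Σ f xs ≡ + length xs * c
    Σ-≡ []                = refl
    Σ-≡ {x ∷ xs} (p ∷ ps) = trans (cong₂ _+_ p (Σ-≡ ps)) (sym (suc-* (length xs) c))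

    -- One strict summand would make the whole sum strict, as the others cannot compensate.
    Σ-≡⁻ : ∀ {xs} → All (λ x → f x ≤ c) xs → Σ f xs ≡ + length xs * c →
           All (λ x → f x ≡ c) xs
    Σ-≡⁻ []                _  = []
    Σ-≡⁻ {x ∷ xs} (p ∷ ps) eq = fx≡c ∷ Σ-≡⁻ ps (+-cancelˡ c _ _
      (trans (cong (λ a → a + Σ f xs) (sym fx≡c)) (trans eq (suc-* (length xs) c))))
      where
      fx≡c : f x ≡ c
      fx≡c = ℤ.≤-antisym p (ℤ.≮⇒≥ λ fx<c → ℤ.<-irrefl (trans eq (suc-* (length xs) c))
        (ℤ.+-mono-<-≤ fx<c (Σ-≤ ps)))

  Σ-cartesianProduct : ∀ {X Y : Set} (f : X × Y → ℤ) xs ys →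
    Σ f (cartesianProduct xs ys) ≡ Σ (λ x → Σ (λ y → f (x , y)) ys) xs
  Σ-cartesianProduct f []       ys = refl
  Σ-cartesianProduct f (x ∷ xs) ys = trans (Σ-++ f (List.map (x ,_) ys) _)
    (cong₂ _+_ (Σ-map f (x ,_) ys) (Σ-cartesianProduct f xs ys))

  length-cartesianProduct : ∀ {X Y : Set} (xs : List X) (ys : List Y) →
    length (cartesianProduct xs ys) ≡ length xs ℕ.* length ys
  length-cartesianProduct []       ys = refl
  length-cartesianProduct (x ∷ xs) ys = trans (List.length-++ (List.map (x ,_) ys))
    (cong₂ ℕ._+_ (List.length-map (x ,_) ys) (length-cartesianProduct xs ys))

  length-choices : ∀ n m → length (choices n m) ≡ n C m
  length-choices n       zero    = refl
  length-choices zero    (suc m) = refl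
  length-choices (suc n) (suc m) = begin
    length (choices (suc n) (suc m))
      ≡⟨ List.length-++ (List.map zero∷_ (choices n m)) ⟩
    length (List.map zero∷_ (choices n m)) ℕ.+ length (List.map sucs (choices n (suc m)))
      ≡⟨ cong₂ ℕ._+_ (List.length-map zero∷_ (choices n m))
           (List.length-map sucs (choices n (suc m))) ⟩
    length (choices n m) ℕ.+ length (choices n (suc m))
      ≡⟨ cong₂ ℕ._+_ (length-choices n m) (length-choices n (suc m)) ⟩
    (n C m) ℕ.+ (n C suc m)
      ≡⟨ nCk+nC[k+1]≡[n+1]C[k+1] n m ⟩
    suc n C suc m
      ∎
    where open ≡-Reasoning

  Z+Y≡nCm² : ∀ m (A : Matrix ℤ n n) → Z m A ℕ.+ Y m A ≡ (n C m) ℕ.* (n C m)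
  Z+Y≡nCm² {n} m A = begin
    Z m A ℕ.+ Y m A
      ≡⟨ split (minors m A) ⟩
    length (minors m A)
      ≡⟨ List.length-map _ (cartesianProduct (choices n m) (choices n m)) ⟩
    length (cartesianProduct (choices n m) (choices n m))
      ≡⟨ length-cartesianProduct (choices n m) (choices n m) ⟩
    length (choices n m) ℕ.* length (choices n m)
      ≡⟨ cong₂ ℕ._*_ (length-choices n m) (length-choices n m) ⟩
    (n C m) ℕ.* (n C m)
      ∎
    where
    open ≡-Reasoning
    split : ∀ ds → length (filter (ℤ._≟ 0ℤ) ds) ℕ.+ length (nonzero ds) ≡ length ds
    split []       = refl
    split (d ∷ ds) with d ℤ.≟ 0ℤ
    ... | yes _ = cong suc (split ds)
    ... | no  _ = trans (ℕ.+-suc _ _) (cong suc (split ds))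

  -- Squared minors grouped by rows, and the count with its equality case

  rows : Matrix ℤ n n → Vec (Fin n) m → Matrix ℤ m n
  rows A r = A ∘ lookup r

  Σminors² : ∀ m (A : Matrix ℤ n n) →
    Σ (λ d → d * d) (minors m A) ≡ Σ (λ r → ∥ ⋀ (rows A r) ∥²) (choices n m)
  Σminors² {n} m A = begin
    Σ (λ d → d * d) (minors m A)
      ≡⟨ Σ-map _ _ (cartesianProduct (choices n m) (choices n m)) ⟩
    Σ (λ (r , c) → minor r c * minor r c) (cartesianProduct (choices n m) (choices n m))
      ≡⟨ Σ-cartesianProduct _ (choices n m) (choices n m) ⟩
    Σ (λ r → Σ (λ c → minor r c * minor r c) (choices n m)) (choices n m)
      ≡⟨ Σ-cong (choices n m) ⟩
    Σ (λ r → ∥ ⋀ (rows A r) ∥²) (choices n m)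
      ∎
    where
    open ≡-Reasoning
    minor : Vec (Fin n) m → Vec (Fin n) m → ℤ
    minor r c = det (submatrix A r c)
    Σ-cong : ∀ rs → Σ (λ r → Σ (λ c → minor r c * minor r c) (choices n m)) rs ≡
                    Σ (λ r → ∥ ⋀ (rows A r) ∥²) rs
    Σ-cong []       = refl
    Σ-cong (r ∷ rs) = cong₂ _+_
      -- For fixed rows the minors are the coefficients of one wedge: `submatrix A r c` and
      -- `columns (rows A r) c` agree by definition.
      (sym (trans (⟪⟫-cong (⋀≗form (rows A r)) (⋀≗form (rows A r))) (∥form∥² (minor r))))
      (Σ-cong rs)

  signs⇒RowNorms : ∀ (B : Matrix ℤ m n) → SignMatrix B → RowNorms (+ n) B
  signs⇒RowNorms B signs i = lemma (B i) (signs i)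
    where
    a² : ∀ {a} → a ≡ 1ℤ ⊎ a ≡ -1ℤ → a * a ≡ 1ℤ
    a² (inj₁ refl) = refl
    a² (inj₂ refl) = refl
    lemma : ∀ {n} (b : Vector ℤ n) → (∀ j → b j ≡ 1ℤ ⊎ b j ≡ -1ℤ) → b · b ≡ + n
    lemma {zero}  b s = refl
    lemma {suc n} b s = cong₂ _+_ (a² (s zero)) (lemma (tail b) (λ j → s (suc j)))

  pos-^ : ∀ n m → + (n ℕ.^ m) ≡ (+ n) ^ m
  pos-^ n zero    = refl
  pos-^ n (suc m) = trans (ℤ.pos-* n (n ℕ.^ m)) (cong (λ a → + n * a) (pos-^ n m))

  increasing⇒injective : ∀ {v : Vec (Fin n) m} → Increasing v → ∀ i j → lookup v i ≡ lookup v j → i ≡ j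
  increasing⇒injective inc = lookup-injective (AllPairs.map Fin.<⇒≢ inc)

  Contains : (i j : Fin n) → Vec (Fin n) m → Set
  Contains i j r = ∃₂ λ a b → a ≢ b × lookup r a ≡ i × lookup r b ≡ j

  -- For `m` equal to 3 a third index is inserted: 0 if it is free, otherwise 1 if that is free,
  -- otherwise 2, which exists because 3 ≤ n.
  ∃-choice∋ : ∀ m → 1 ℕ.< m → m ℕ.≤ 3 → m ℕ.≤ n → (i j : Fin n) → i Fin.< j →
    ∃[ r ] Increasing {n} {m} r × Contains i j r
  ∃-choice∋ 2 _ _ _ i j i<j =
    i ∷ j ∷ [] , (i<j ∷ []) ∷ [] ∷ [] , zero , suc zero , (λ ()) , refl , refl
  ∃-choice∋ 3 _ _ _ i@(suc _) j i<j =
    zero ∷ i ∷ j ∷ [] , (z<s ∷ ℕ.<-trans z<s i<j ∷ []) ∷ (i<j ∷ []) ∷ [] ∷ [] ,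
    suc zero , suc (suc zero) , (λ ()) , refl , refl
  ∃-choice∋ 3 _ _ (s≤s (s≤s (s≤s _))) zero (suc zero) _ =
    zero ∷ suc zero ∷ suc (suc zero) ∷ [] , (z<s ∷ z<s ∷ []) ∷ (s<s z<s ∷ []) ∷ [] ∷ [] ,
    zero , suc zero , (λ ()) , refl , refl
  ∃-choice∋ 3 _ _ (s≤s (s≤s (s≤s _))) zero j@(suc (suc _)) _ =
    zero ∷ suc zero ∷ j ∷ [] , (z<s ∷ z<s ∷ []) ∷ (s<s z<s ∷ []) ∷ [] ∷ [] ,
    zero , suc (suc zero) , (λ ()) , refl , refl
  ∃-choice∋ 1 (s≤s ())
  ∃-choice∋ (suc (suc (suc (suc _)))) _ (s≤s (s≤s (s≤s ())))

  module _ (p k : ℕ) (A : Matrix ℤ (suc p) (suc p)) (signs : SignMatrix A) where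

    private
      N M : ℕ
      N = suc p
      M = suc k

      -- By Cauchy-Binet, the Gram determinant of the chosen rows.
      gram : Vec (Fin N) M → ℤ
      gram r = ∥ ⋀ (rows A r) ∥²

      norms : ∀ (r : Vec (Fin N) M) → RowNorms (+ N) (rows A r)
      norms r = signs⇒RowNorms (rows A r) (λ i → signs (lookup r i))

      gram≤ : All (λ r → gram r ≤ (+ N) ^ M) (choices N M)
      gram≤ = All.universal (λ r → ∥⋀∥²≤ (rows A r) (norms r)) _

      pos-bound : + ((N C M) ℕ.* N ℕ.^ M) ≡ + length (choices N M) * (+ N) ^ M
      pos-bound = trans (ℤ.pos-* (N C M) (N ℕ.^ M))
        (cong₂ _*_ (cong +_ (sym (length-choices N M))) (pos-^ N M))

      pos-Y4^ : + (Y M A ℕ.* 4 ℕ.^ k) ≡ + Y M A * + (4 ℕ.^ k)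
      pos-Y4^ = ℤ.pos-* (Y M A) (4 ℕ.^ k)

      minors-All : ∀ {P : ℤ → Set} → (∀ B → SignMatrix B → P (det B)) → All P (minors M A)
      minors-All h = All.map⁺ (All.universal
        (λ (r , c) → h (submatrix A r c) (λ i j → signs (lookup r i) (lookup c j))) _)

    -- The sum of all squared minors is estimated twice: from below by 4^(M-1) for each nonzero
    -- minor, from above by N^M for each choice of rows.
    Y4^≤ : Y M A ℕ.* 4 ℕ.^ k ℕ.≤ (N C M) ℕ.* N ℕ.^ M
    Y4^≤ = ℤ.drop‿+≤+ (begin
      + (Y M A ℕ.* 4 ℕ.^ k)               ≡⟨ pos-Y4^ ⟩
      + Y M A * + (4 ℕ.^ k)               ≤⟨ count-nonzero-≤
        (minors-All λ B s → 2^∣⇒≡0⊎4^≤ {k} (2^∣det B s)) ⟩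
      Σ (λ d → d * d) (minors M A)        ≡⟨ Σminors² M A ⟩
      Σ gram (choices N M)                ≤⟨ Σ-≤ gram≤ ⟩
      + length (choices N M) * (+ N) ^ M  ≡⟨ pos-bound ⟨
      + ((N C M) ℕ.* N ℕ.^ M)             ∎)
      where open ℤ.≤-Reasoning

    Y4^≡⇔Hadamard : 1 ℕ.< M → M ℕ.≤ 3 → M ℕ.≤ N →
      (Y M A ℕ.* 4 ℕ.^ k ≡ (N C M) ℕ.* N ℕ.^ M) ⇔ IsHadamard A
    Y4^≡⇔Hadamard 1<M M≤3 M≤N = mk⇔ to from
      where
      -- For M ≤ 3 the lower estimate is exact, so only the upper one decides equality.
      Y4^≡Σ : + (Y M A ℕ.* 4 ℕ.^ k) ≡ Σ gram (choices N M)
      Y4^≡Σ = trans pos-Y4^ (trans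
        (count-nonzero-≡ (minors-All (λ B s → 2^∣⇒≡0⊎≡4^ {k} M≤3 (∣det∣≤m! B s) (2^∣det B s)))) (Σminors² M A))

      to : Y M A ℕ.* 4 ℕ.^ k ≡ (N C M) ℕ.* N ℕ.^ M → IsHadamard A
      to eq = record { entries = signs ; HHᵀ≡nI = HHᵀ }
        where
        gram≡ : All (λ r → gram r ≡ (+ N) ^ M) (choices N M)
        gram≡ = Σ-≡⁻ gram≤ (trans (sym Y4^≡Σ) (trans (cong +_ eq) pos-bound))
        -- Choices are increasing, so they yield ordered pairs; symmetry gives the others.
        orth< : ∀ i j → i Fin.< j → A i · A j ≡ 0ℤ
        orth< i j i<j with r , inc , a , b , a≢b , refl , refl ← ∃-choice∋ M 1<M M≤3 M≤N i j i<j =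
          ∥⋀∥²≡⇒Orthogonal (rows A r) (norms r) (All.lookup gram≡ (∈-choices⁺ inc)) a b a≢b
        HHᵀ : ∀ i j → (A ⊗ transpose A) i j ≡ scalar (+ N) i j
        HHᵀ i j with i Fin.≟ j
        ... | yes refl = signs⇒RowNorms A signs i
        ... | no i≢j with Fin.<-cmp i j
        ...   | tri< i<j _ _ = orth< i j i<j
        ...   | tri≈ _ i≡j _ = contradiction i≡j i≢j
        ...   | tri> _ _ j<i = trans (·-comm (A i) (A j)) (orth< j i j<i)

      from : IsHadamard A → Y M A ℕ.* 4 ℕ.^ k ≡ (N C M) ℕ.* N ℕ.^ M
      from H = ℤ.+-injective (trans Y4^≡Σ (trans (Σ-≡ gram≡) (sym pos-bound)))
        where
        orth : Orthogonal A
        orth i j i≢j with i Fin.≟ j | IsHadamard.HHᵀ≡nI H i j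
        ... | yes i≡j | _  = contradiction i≡j i≢j
        ... | no _    | eq = eq
        gram≡ : All (λ r → gram r ≡ (+ N) ^ M) (choices N M)
        gram≡ = All.tabulate λ {r} r∈ → Orthogonal⇒∥⋀∥²≡ (rows A r) (norms r)
          λ i j i≢j → orth _ _ (i≢j ∘ increasing⇒injective (∈-choices⁻ r∈) i j)

  -- Rational arithmetic

  -- The gcd hidden in `/ 1` does not compute for a variable `a`; rewriting to `mkℚ` lets the
  -- rational operations reduce.
  fromℕ≡mkℚ : ∀ a → fromℕ a ≡ mkℚ (+ a) 0 (ℕ.sym (ℕ.1-coprimeTo a))
  fromℕ≡mkℚ a = ℚ.normalize-coprime (ℕ.sym (ℕ.1-coprimeTo a))

  fromℕ-* : ∀ a b → fromℕ (a ℕ.* b) ≡ fromℕ a ℚ.* fromℕ b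
  fromℕ-* a b rewrite fromℕ≡mkℚ a | fromℕ≡mkℚ b = cong (_/ 1) (ℤ.pos-* a b)

  fromℕ-+ : ∀ a b → fromℕ (a ℕ.+ b) ≡ fromℕ a ℚ.+ fromℕ b
  fromℕ-+ a b rewrite fromℕ≡mkℚ a | fromℕ≡mkℚ b =
    cong (_/ 1) (trans (ℤ.pos-+ a b) (sym (cong₂ _+_ (ℤ.*-identityʳ (+ a)) (ℤ.*-identityʳ (+ b)))))

  fromℕ-mono-≤ : ∀ {a b} → a ℕ.≤ b → fromℕ a ℚ.≤ fromℕ b
  fromℕ-mono-≤ {a} {b} a≤b rewrite fromℕ≡mkℚ a | fromℕ≡mkℚ b =
    ℚ.*≤* (ℤ.*-monoʳ-≤-nonNeg (+ 1) (+≤+ a≤b))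

  fromℕ-injective : ∀ {a b} → fromℕ a ≡ fromℕ b → a ≡ b
  fromℕ-injective {a} {b} eq = ℤ.+-injective
    (cong ℚ.numerator (trans (sym (fromℕ≡mkℚ a)) (trans eq (fromℕ≡mkℚ b))))

  *-cancelʳ-≡-pos : ∀ {p q} r .{{_ : ℚ.Positive r}} → p ℚ.* r ≡ q ℚ.* r → p ≡ q
  *-cancelʳ-≡-pos r eq = ℚ.≤-antisym
    (ℚ.*-cancelʳ-≤-pos r (ℚ.≤-reflexive eq)) (ℚ.*-cancelʳ-≤-pos r (ℚ.≤-reflexive (sym eq)))

  -- As n / 4 need not be in lowest terms, the product is compared among unnormalised fractions.
  [n/4]*4≡n : ∀ n → (+ n / 4) ℚ.* fromℕ 4 ≡ fromℕ n
  [n/4]*4≡n n = ℚ.toℚᵘ-injective (begin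
      ℚ.toℚᵘ ((+ n / 4) ℚ.* fromℕ 4)   ≈⟨ ℚ.toℚᵘ-homo-* (+ n / 4) (fromℕ 4) ⟩
      ℚ.toℚᵘ (+ n / 4) ℚᵘ.* mkℚᵘ (+ 4) 0
        ≈⟨ ℚᵘ.*-congʳ (ℚ.toℚᵘ-fromℚᵘ (mkℚᵘ (+ n) 3)) ⟩
      mkℚᵘ (+ n) 3 ℚᵘ.* mkℚᵘ (+ 4) 0   ≈⟨ *≡* (ℤ.*-identityʳ (+ n * + 4)) ⟩
      mkℚᵘ (+ n) 0                     ≈⟨ ℚ.toℚᵘ-fromℚᵘ (mkℚᵘ (+ n) 0) ⟨
      ℚ.toℚᵘ (fromℕ n)                 ∎)
    where open ℚᵘ.≃-Reasoning

open import Data.Rational.Base using (_*_; _-_; _≤_; _≥_)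

boundFactor : ℕ → ℕ → ℚ
boundFactor n m = fromℕ 4 * (+ n / 4) ^ℚ m

[n/4]^m*4^m≡n^m : ∀ n m → (+ n / 4) ^ℚ m * fromℕ (4 ℕ.^ m) ≡ fromℕ (n ℕ.^ m)
[n/4]^m*4^m≡n^m n zero    = refl
[n/4]^m*4^m≡n^m n (suc m) = begin
  x * x ^ℚ m * fromℕ (4 ℕ.* 4 ℕ.^ m)          ≡⟨ cong (λ a → x * x ^ℚ m * a) (fromℕ-* 4 (4 ℕ.^ m)) ⟩
  x * x ^ℚ m * (fromℕ 4 * fromℕ (4 ℕ.^ m))    ≡⟨ lemma x (x ^ℚ m) (fromℕ 4) (fromℕ (4 ℕ.^ m)) ⟩
  x * fromℕ 4 * (x ^ℚ m * fromℕ (4 ℕ.^ m))    ≡⟨ cong₂ _*_ ([n/4]*4≡n n) ([n/4]^m*4^m≡n^m n m) ⟩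
  fromℕ n * fromℕ (n ℕ.^ m)                   ≡⟨ fromℕ-* n (n ℕ.^ m) ⟨
  fromℕ (n ℕ.^ suc m)                         ∎
  where
  open ≡-Reasoning
  open +-*-Solver
  x = + n / 4
  lemma : ∀ a b c d → a * b * (c * d) ≡ a * c * (b * d)
  lemma = solve 4 (λ a b c d → a :* b :* (c :* d) := a :* c :* (b :* d)) refl

-- The leading 4 of the bound makes up the difference between 4^k, which divides out of the squared
-- minors, and the 4^(k+1) in the denominator of the power.
boundFactor*b*4^k : ∀ n k b →
  boundFactor n (suc k) * fromℕ b * fromℕ (4 ℕ.^ k) ≡ fromℕ (b ℕ.* n ℕ.^ suc k)
boundFactor*b*4^k n k b = begin
  fromℕ 4 * y * fromℕ b * fromℕ (4 ℕ.^ k)     ≡⟨ lemma (fromℕ 4) y (fromℕ b) (fromℕ (4 ℕ.^ k)) ⟩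
  fromℕ b * (y * (fromℕ 4 * fromℕ (4 ℕ.^ k))) ≡⟨ cong (λ q → fromℕ b * (y * q)) (fromℕ-* 4 (4 ℕ.^ k)) ⟨
  fromℕ b * (y * fromℕ (4 ℕ.^ suc k))         ≡⟨ cong (λ a → fromℕ b * a) ([n/4]^m*4^m≡n^m n (suc k)) ⟩
  fromℕ b * fromℕ (n ℕ.^ suc k)               ≡⟨ fromℕ-* b (n ℕ.^ suc k) ⟨
  fromℕ (b ℕ.* n ℕ.^ suc k)                   ∎
  where
  open ≡-Reasoning
  open +-*-Solver
  y = (+ n / 4) ^ℚ suc k
  lemma : ∀ a b c d → a * b * c * d ≡ c * (b * (a * d))
  lemma = solve 4 (λ a b c d → a :* b :* c :* d := c :* (b :* (a :* d))) refl

module _ (n k b y : ℕ) where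

  private instance
    4^k>0 : ℚ.Positive (fromℕ (4 ℕ.^ k))
    4^k>0 = ℚ.normalize-pos (4 ℕ.^ k) 1 {{_}} {{ℕ.m^n≢0 4 k}}

  scaled-≤ : y ℕ.* 4 ℕ.^ k ℕ.≤ b ℕ.* n ℕ.^ suc k →
             fromℕ y ≤ boundFactor n (suc k) * fromℕ b
  scaled-≤ y4^k≤ = ℚ.*-cancelʳ-≤-pos (fromℕ (4 ℕ.^ k)) (begin
    fromℕ y * fromℕ (4 ℕ.^ k)                       ≡⟨ fromℕ-* y (4 ℕ.^ k) ⟨
    fromℕ (y ℕ.* 4 ℕ.^ k)                           ≤⟨ fromℕ-mono-≤ y4^k≤ ⟩
    fromℕ (b ℕ.* n ℕ.^ suc k)                       ≡⟨ boundFactor*b*4^k n k b ⟨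
    boundFactor n (suc k) * fromℕ b * fromℕ (4 ℕ.^ k)    ∎)
    where open ℚ.≤-Reasoning

  scaled-≡ : (fromℕ y ≡ boundFactor n (suc k) * fromℕ b) ⇔ (y ℕ.* 4 ℕ.^ k ≡ b ℕ.* n ℕ.^ suc k)
  scaled-≡ = mk⇔
    (λ eq → fromℕ-injective (trans (fromℕ-* y (4 ℕ.^ k))
      (trans (cong (_* fromℕ (4 ℕ.^ k)) eq) (boundFactor*b*4^k n k b))))
    (λ eq → *-cancelʳ-≡-pos (fromℕ (4 ℕ.^ k)) (trans (sym (fromℕ-* y (4 ℕ.^ k)))
      (trans (cong fromℕ eq) (sym (boundFactor*b*4^k n k b)))))

module _ (z y b f : ℚ) (z+y≡b*b : z ℚ.+ y ≡ b * b) where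

  private
    open +-*-Solver

    -- Both bounds have the same slack, z - b (b - f) = f b - y, so the inequality and its equality
    -- case pass from nonzero to zero minors.
    b*[b-f]≡ : b * (b - f) ≡ z ℚ.+ (y - f * b)
    b*[b-f]≡ = trans (lemma₁ b f) (trans (cong (_- f * b) (sym z+y≡b*b)) (lemma₂ z y (f * b)))
      where
      lemma₁ : ∀ b f → b * (b - f) ≡ b * b - f * b
      lemma₁ = solve 2 (λ b f → b :* (b :- f) := b :* b :- f :* b) refl
      lemma₂ : ∀ z y c → z ℚ.+ y - c ≡ z ℚ.+ (y - c)
      lemma₂ = solve 3 (λ z y c → z :+ y :- c := z :+ (y :- c)) refl

  complement-≥ : y ≤ f * b → z ≥ b * (b - f)
  complement-≥ y≤ = begin
    b * (b - f)           ≡⟨ b*[b-f]≡ ⟩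
    z ℚ.+ (y - f * b)     ≤⟨ ℚ.+-monoʳ-≤ z (ℚ.+-monoˡ-≤ (ℚ.- (f * b)) y≤) ⟩
    z ℚ.+ (f * b - f * b) ≡⟨ lemma z (f * b) ⟩
    z                     ∎
    where
    open ℚ.≤-Reasoning
    lemma : ∀ z c → z ℚ.+ (c - c) ≡ z
    lemma = solve 2 (λ z c → z :+ (c :- c) := z) refl

  complement-≡ : (z ≡ b * (b - f)) ⇔ (y ≡ f * b)
  complement-≡ = mk⇔
    (λ eq → begin
      y                              ≡⟨ lemma z y (f * b) ⟩
      z ℚ.+ (y - f * b) - z ℚ.+ f * b ≡⟨ cong (λ a → a - z ℚ.+ f * b) (trans (sym b*[b-f]≡) (sym eq)) ⟩
      z - z ℚ.+ f * b                ≡⟨ lemma′ z (f * b) ⟩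
      f * b                          ∎)
    (λ eq → sym (trans b*[b-f]≡ (trans (cong (λ a → z ℚ.+ (a - f * b)) eq) (lemma″ z (f * b)))))
    where
    open ≡-Reasoning
    lemma : ∀ z y c → y ≡ z ℚ.+ (y - c) - z ℚ.+ c
    lemma = solve 3 (λ z y c → y := z :+ (y :- c) :- z :+ c) refl
    lemma′ : ∀ z c → z - z ℚ.+ c ≡ c
    lemma′ = solve 2 (λ z c → z :- z :+ c := c) refl
    lemma″ : ∀ z c → z ℚ.+ (c - c) ≡ z
    lemma″ = solve 2 (λ z c → z :+ (c :- c) := z) refl

corollary2 :
    (n m : ℕ) → n ℕ.≥ m → m ℕ.> 1 →
    (A : Matrix ℤ n n) → SignMatrix A →
    let binom  = fromℕ (n C m)
        factor = fromℕ 4 * (+ n / 4) ^ℚ m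
    in
    (fromℕ (Y m A) ≤ factor * binom) ×
    (fromℕ (Z m A) ≥ binom * (binom - factor)) ×
    (m ℕ.≤ 3 →
      (fromℕ (Y m A) ≡ factor * binom ⇔ IsHadamard A) ×
      (fromℕ (Z m A) ≡ binom * (binom - factor) ⇔ IsHadamard A))
corollary2 zero    (suc _) () _ _ _
corollary2 (suc p) (suc k) n≥m m>1 A signs =
    Y≤ ,
    complement-≥ z (fromℕ y) (fromℕ b) f Z+Y Y≤ ,
    λ m≤3 → let Y≡⇔ = Y4^≡⇔Hadamard p k A signs m>1 m≤3 n≥m ⇔-∘ scaled-≡ (suc p) k b y in
      Y≡⇔ , Y≡⇔ ⇔-∘ complement-≡ z (fromℕ y) (fromℕ b) f Z+Y
  where
  b = suc p C suc k
  y = Y (suc k) A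
  z = fromℕ (Z (suc k) A)
  f = boundFactor (suc p) (suc k)
  Y≤ : fromℕ y ≤ f * fromℕ b
  Y≤ = scaled-≤ (suc p) k b y (Y4^≤ p k A signs)
  Z+Y : z ℚ.+ fromℕ y ≡ fromℕ b * fromℕ b
  Z+Y = trans (sym (fromℕ-+ (Z (suc k) A) y))
    (trans (cong fromℕ (Z+Y≡nCm² (suc k) A)) (fromℕ-* b b))
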